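{- Let $G$ be a connected 4-regular graph and let $v,w$ be adjacent vertices of $G$ such that the neighbours of $w$ are exactly $v,a,b,c$ and the neighbours of $v$ are exactly $w,c,d,e$, where $a,b,c,d,e$ are distinct. Let $S=G-\{v,w\}$. Then there is a fixed-point free involution on \[ \mathcal{S}_{\{a\},\{b,c,d,e\}} \cup \mathcal{S}_{\{b\},\{a,c,d,e\}} \cup \mathcal{S}_{\{d\},\{a,b,c,e\}} \cup \mathcal{S}_{\{e\},\{a,b,c,d\}}, \] and thus \[ s_{\{a\},\{b,c,d,e\}} + s_{\{b\},\{a,c,d,e\}} + s_{\{d\},\{a,b,c,e\}} + s_{\{e\},\{a,b,c,d\}} \equiv 0 \pmod 2. \]
   Context: $G-\{v,w\}$ is the graph obtained by deleting $v,w$ and all incident edges. A spanning 2-forest of a graph is a spanning forest with exactly two trees. If $P=P_1\cup P_2$ is a bipartition of a set of vertices, a spanning 2-forest is compatible with $P$ if one of its trees contains all vertices of $P_1$ and none of $P_2$, and the other contains all vertices of $P_2$ and none of $P_1$. For a bipartition $P$ of $\{a,b,c,d,e\}$, $\mathcal{S}_P$ is the set of bipartitions $(\psi,\phi)$ of the edge set of $S$ such that $\psi$ is a spanning tree of $S$ and $\phi$ is a spanning 2-forest of $S$ compatible with $P$; $s_P=|\mathcal{S}_P|$. -}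

module Defs where

open import Data.Nat using (ℕ; _+_)
open import Data.Nat.Divisibility using (_∣_)
open import Data.Bool using (false; true)
open import Data.Fin using (Fin; _≟_)
open import Data.Fin.Subset using (Subset; _∈_)
open import Data.Vec using (_[_]≔_; replicate)
open import Data.List using (List; []; _∷_; _++_; map; allFin; length)
open import Data.Nat.ListAction using (sum)
import Data.List.Membership.Propositional as LM
open import Data.List.Relation.Unary.Unique.Propositional using (Unique)
open import Data.Product using (Σ; ∃; _×_; _,_; proj₁; proj₂)
open import Data.Sum using (_⊎_)
open import Relation.Nullary using (¬_)
open import Relation.Nullary.Decidable using (⌊_⌋)
open import Data.Bool using (if_then_else_)
open import Relation.Binary.PropositionalEquality using (_≡_; _≢_)
open import Function using (_⇔_)

record Graph : Set where
  field
    n m  : ℕ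
    ends : Fin m → Fin n × Fin n

open Graph public

Vtx : Graph → Set
Vtx G = Fin (n G)

ESet : Graph → Set
ESet G = Subset (m G)

Joins : (G : Graph) → Fin (m G) → Vtx G → Vtx G → Set
Joins G e x y = ends G e ≡ (x , y) ⊎ ends G e ≡ (y , x)

Adj : (G : Graph) → Vtx G → Vtx G → Set
Adj G x y = ∃ λ e → Joins G e x y

-- degree: number of edge-ends at x (a loop would count twice)
deg : (G : Graph) → Vtx G → ℕ
deg G x = sum (map (λ e → ind (proj₁ (ends G e)) + ind (proj₂ (ends G e))) (allFin (m G)))
  where
  ind : Vtx G → ℕ
  ind y = if ⌊ y ≟ x ⌋ then 1 else 0

data Walk (G : Graph) (F : ESet G) : Vtx G → Vtx G → Set where
  here : ∀ {x} → Walk G F x x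
  step : ∀ {x y z} (e : Fin (m G)) → e ∈ F → Joins G e x y → Walk G F y z → Walk G F x z

Connected : Graph → Set
Connected G = ∀ x y → Walk G (replicate (m G) true) x y

Acyclic : (G : Graph) → ESet G → Set
Acyclic G F = ∀ e → e ∈ F → ¬ Walk G (F [ e ]≔ false) (proj₁ (ends G e)) (proj₂ (ends G e))

module _ (G : Graph) (v w : Vtx G) where

  VertS : Vtx G → Set
  VertS x = x ≢ v × x ≢ w

  EdgeS : Fin (m G) → Set
  EdgeS e = VertS (proj₁ (ends G e)) × VertS (proj₂ (ends G e))

  EdgeBipartition : ESet G → ESet G → Set
  EdgeBipartition ψ φ = ∀ e → ((e ∈ ψ ⊎ e ∈ φ) ⇔ EdgeS e) × ¬ (e ∈ ψ × e ∈ φ)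

  -- ψ (⊆ E(S)) is a spanning tree of S
  SpanningTreeS : ESet G → Set
  SpanningTreeS ψ = Acyclic G ψ × (∀ x y → VertS x → VertS y → Walk G ψ x y)

  -- φ (⊆ E(S)) is a spanning 2-forest of S compatible with P = P₁ ∪ P₂:
  -- acyclic, exactly two components, one containing all of P₁ and none of P₂,
  -- the other containing all of P₂ and none of P₁ (P₁, P₂ nonempty here).
  Compatible2ForestS : List (Vtx G) → List (Vtx G) → ESet G → Set
  Compatible2ForestS P₁ P₂ φ =
    Acyclic G φ
    × (∀ x y → x LM.∈ P₁ → y LM.∈ P₁ → Walk G φ x y)
    × (∀ x y → x LM.∈ P₂ → y LM.∈ P₂ → Walk G φ x y)
    × (∀ x y → x LM.∈ P₁ → y LM.∈ P₂ → ¬ Walk G φ x y)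
    × (∀ x → VertS x → ∃ λ p → p LM.∈ (P₁ ++ P₂) × Walk G φ x p)

  InSP : List (Vtx G) → List (Vtx G) → ESet G × ESet G → Set
  InSP P₁ P₂ (ψ , φ) = EdgeBipartition ψ φ × SpanningTreeS ψ × Compatible2ForestS P₁ P₂ φ

-- L is a duplicate-free list of exactly the elements satisfying P; then length L = |P|
Enumerates : {A : Set} → (A → Set) → List A → Set
Enumerates P L = Unique L × (∀ x → x LM.∈ L ⇔ P x)

{-# OPTIONS --safe #-}

-- The vertex c has exactly two edges in S, to y₁ and y₂ say, and it is a leaf of both ψ and φ.
-- Deleting it leaves pairs (ψ, φ) on S - c, with ψ a spanning tree and φ a 2-forest, and modulo 2
-- the sum counts those for which φ separates y₁ from y₂ and splits {a,b,d,e} oddly.  By the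
-- handshake lemma (degrees modulo 2 in S - c) these are the pairs where φ separates y₁ from y₂ and
-- the number k of edges crossing between the two trees of φ is even.  Exchanging
-- (ψ, φ) ↦ (φ + f, ψ - f) along a crossing edge f shows that the sum of k over the pairs with y₁, y₂
-- separated by φ equals the sum, over all pairs, of the number of crossing edges on the ψ-path from
-- y₁ to y₂.  The latter number is odd exactly when φ separates y₁ from y₂, so the sum of k + 1 over
-- the separating pairs is even.  A finite decidable set of even size has a fixed-point free
-- involution, which pairs up the entries of an enumeration.

module Submission where

open import Defs
open import Data.Bool using (Bool; true; false; not; _∧_; _xor_; if_then_else_)
import Data.Bool as Bool
open import Data.Bool.Properties using (not-distribˡ-xor; not-involutive; xor-assoc; xor-comm; xor-identityʳ; xor-same; ∧-assoc; ∧-comm; ∧-distribˡ-xor; ∧-identityʳ; ∧-zeroʳ)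
open import Data.Fin using (Fin; _≟_)
open import Data.Fin.Properties using (all?; any?)
open import Data.Fin.Subset using (Subset) renaming (_∈_ to _∈ˢ_; _∉_ to _∉ˢ_)
open import Data.Fin.Subset.Properties using () renaming (_∈?_ to _∈ˢ?_)
open import Data.List using (List; []; _∷_; _++_; map; filter; length; allFin; cartesianProduct)
import Data.List.Membership.DecPropositional as DecMembership
open import Data.List.Membership.Propositional using (_∈_; _∉_)
open import Data.List.Membership.Propositional.Properties using (∈-allFin; ∈-cartesianProduct⁺; ∈-filter⁺; ∈-filter⁻; ∈-map⁺; ∈-map⁻; ∈-++⁺ˡ; ∈-++⁺ʳ; ∈-++⁻)
open import Data.List.Relation.Binary.Permutation.Propositional as Perm using (_↭_; ↭-sym; prep; swap)
open import Data.List.Relation.Binary.Permutation.Propositional.Properties using (All-resp-↭; ∈-resp-↭; map⁺; shift)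
open import Data.List.Relation.Unary.All as All using ([]; _∷_)
open import Data.List.Relation.Unary.All.Properties using (¬Any⇒All¬)
open import Data.List.Relation.Unary.AllPairs using ([]; _∷_)
open import Data.List.Relation.Unary.Any using (here; there)
open import Data.List.Relation.Unary.Unique.Propositional using (Unique)
import Data.List.Relation.Unary.Unique.Propositional.Properties as Uniqueₚ
open import Data.Nat using (ℕ; zero; suc; _+_; _≤_; _<_; _≤?_; z≤n; s≤s)
open import Data.Nat.Divisibility using (_∣_; divides; ∣m∣n⇒∣m+n; ∣-refl)
open import Data.Nat.ListAction using (sum)
open import Data.Nat.ListAction.Properties using (sum-↭)
open import Data.Nat.Properties using (≤-trans; ≤-refl; ≤-reflexive; +-mono-≤; +-monoʳ-≤; m≤n+m; <⇒≱)
open import Data.Product as Product using (Σ; ∃; _×_; _,_; proj₁; proj₂)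
open import Data.Product.Properties using (,-injective) renaming (≡-dec to ×-≡-dec)
open import Data.Sum as Sum using (_⊎_; inj₁; inj₂; [_,_]′)
open import Data.Vec using (Vec; []; _∷_; _[_]≔_; _[_]%=_; lookup)
open import Data.Vec.Properties using (∷-injectiveʳ; []=⇒lookup; lookup⇒[]=; updateAt-minimal; updateAt-updates; updateAt-updateAt-local; updateAt-id; updateAt-cong-local) renaming (≡-dec to Vec-≡-dec)
open import Function using (_∘_; id; const; _⇔_; mk⇔; Equivalence)
open import Relation.Binary.Definitions using (DecidableEquality)
open import Relation.Binary.PropositionalEquality
open import Relation.Nullary using (¬_; Dec; yes; no; does; contradiction; ¬?; _×-dec_; _⊎-dec_; _→-dec_)
open import Relation.Nullary.Decidable using (map′; does-⇔; dec-true; dec-false; toSum; toWitness; ⌊_⌋)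
open import Relation.Unary using (Decidable)

-- For a fixed f the exchange is an involution, but a pair has k crossing edges and no canonical one
-- among them. So the proof counts incidences of pairs with edges modulo 2, and an involution is
-- extracted from the parity only at the end. All counts are sums over F₂ that range over all pairs
-- of edge sets, with the conditions as truth values. Exchanging an edge and deleting the leaf then
-- become toggles, which are involutions of the whole index set and re-index a sum without a domain
-- to keep track of. The handshake step rests on 4-regularity: colour S - c by the trees of φ; then
-- k is congruent to the sum of the colours of a, b, d, e, y₁, y₂, the inner ends of the six edges
-- that leave S - c. If y₁ and y₂ have different colours, they contribute 1, so k is even exactly
-- when a, b, d, e are split oddly. Loops and parallel edges are allowed. In particular c may carry
-- a loop instead of two edges into the rest of S; then all four sets are empty.

private variable
  A B : Set

-- Parities and sums over F₂

xor-interchange : ∀ p q r s → (p xor q) xor (r xor s) ≡ (p xor r) xor (q xor s)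
xor-interchange p q r s = begin
  (p xor q) xor (r xor s) ≡⟨ xor-assoc p q _ ⟩
  p xor (q xor (r xor s)) ≡⟨ cong (p xor_) (xor-assoc q r s) ⟨
  p xor ((q xor r) xor s) ≡⟨ cong (λ t → p xor (t xor s)) (xor-comm q r) ⟩
  p xor ((r xor q) xor s) ≡⟨ cong (p xor_) (xor-assoc r q s) ⟩
  p xor (r xor (q xor s)) ≡⟨ xor-assoc p r _ ⟨
  (p xor r) xor (q xor s) ∎
  where open ≡-Reasoning

odd : ℕ → Bool
odd zero    = false
odd (suc n) = not (odd n)

odd-+ : ∀ m n → odd (m + n) ≡ odd m xor odd n
odd-+ zero    n = refl
odd-+ (suc m) n = trans (cong not (odd-+ m n)) (not-distribˡ-xor (odd m) (odd n))

even⇒2∣ : ∀ n → odd n ≡ false → 2 ∣ n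
even⇒2∣ zero          _ = divides 0 refl
even⇒2∣ (suc (suc n)) p = ∣m∣n⇒∣m+n ∣-refl (even⇒2∣ n (trans (sym (not-involutive (odd n))) p))

⨁ : List A → (A → Bool) → Bool
⨁ []       f = false
⨁ (x ∷ xs) f = f x xor ⨁ xs f

⨁-cong : ∀ (xs : List A) {f g : A → Bool} → (∀ x → f x ≡ g x) → ⨁ xs f ≡ ⨁ xs g
⨁-cong []       p = refl
⨁-cong (x ∷ xs) p = cong₂ _xor_ (p x) (⨁-cong xs p)

⨁-false : ∀ (xs : List A) → ⨁ xs (const false) ≡ false
⨁-false []       = refl
⨁-false (_ ∷ xs) = ⨁-false xs

⨁-xor : ∀ (xs : List A) (f g : A → Bool) → ⨁ xs (λ x → f x xor g x) ≡ ⨁ xs f xor ⨁ xs g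
⨁-xor []       f g = refl
⨁-xor (x ∷ xs) f g =
  trans (cong ((f x xor g x) xor_) (⨁-xor xs f g)) (xor-interchange (f x) (g x) _ _)

⨁-∧ˡ : ∀ (xs : List A) b (f : A → Bool) → ⨁ xs (λ x → b ∧ f x) ≡ b ∧ ⨁ xs f
⨁-∧ˡ []       b f = sym (∧-zeroʳ b)
⨁-∧ˡ (x ∷ xs) b f =
  trans (cong ((b ∧ f x) xor_) (⨁-∧ˡ xs b f)) (sym (∧-distribˡ-xor b (f x) _))

⨁-swap : ∀ (xs : List A) (ys : List B) (f : A → B → Bool) →
         ⨁ xs (λ x → ⨁ ys (f x)) ≡ ⨁ ys (λ y → ⨁ xs (λ x → f x y))
⨁-swap []       ys f = sym (⨁-false ys)
⨁-swap (x ∷ xs) ys f = trans (cong (⨁ ys (f x) xor_) (⨁-swap xs ys f))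
                             (sym (⨁-xor ys (f x) _))

⨁-map : ∀ (h : A → B) (f : B → Bool) xs → ⨁ (map h xs) f ≡ ⨁ xs (f ∘ h)
⨁-map h f []       = refl
⨁-map h f (x ∷ xs) = cong (f (h x) xor_) (⨁-map h f xs)

⨁-↭ : ∀ (f : A → Bool) {xs ys} → xs ↭ ys → ⨁ xs f ≡ ⨁ ys f
⨁-↭ f Perm.refl        = refl
⨁-↭ f (prep x p)       = cong (f x xor_) (⨁-↭ f p)
⨁-↭ f (Perm.trans p q) = trans (⨁-↭ f p) (⨁-↭ f q)
⨁-↭ f (swap {xs} {ys} x y p) = begin
  f x xor (f y xor ⨁ xs f)   ≡⟨ xor-assoc (f x) (f y) _ ⟨
  (f x xor f y) xor ⨁ xs f   ≡⟨ cong₂ _xor_ (xor-comm (f x) (f y)) (⨁-↭ f p) ⟩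
  (f y xor f x) xor ⨁ ys f   ≡⟨ xor-assoc (f y) (f x) _ ⟩
  f y xor (f x xor ⨁ ys f)   ∎
  where open ≡-Reasoning

⨁-true : ∀ (xs : List A) (f : A → Bool) → (∀ {x} → x ∈ xs → f x ≡ true) →
         ⨁ xs f ≡ odd (length xs)
⨁-true []       f p = refl
⨁-true (x ∷ xs) f p = cong₂ _xor_ (p (here refl)) (⨁-true xs f (p ∘ there))

odd-sum : ∀ (g : A → ℕ) xs → odd (sum (map g xs)) ≡ ⨁ xs (odd ∘ g)
odd-sum g []       = refl
odd-sum g (x ∷ xs) = trans (odd-+ (g x) _) (cong (odd (g x) xor_) (odd-sum g xs))

unique-extract : ∀ {x : A} {ys} → x ∈ ys → Unique ys →
                 ∃ λ zs → (ys ↭ x ∷ zs) × Unique (x ∷ zs)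
unique-extract (here refl) u = _ , Perm.refl , u
unique-extract {ys = y ∷ _} (there x∈ys) (y∉ys ∷ u)
  with zs , p , x∉zs ∷ u′ ← unique-extract x∈ys u
  with y≢x ∷ y∉zs ← All-resp-↭ p y∉ys =
  y ∷ zs , Perm.trans (prep y p) (swap y _ Perm.refl) ,
  ((≢-sym y≢x ∷ x∉zs) ∷ y∉zs ∷ u′)

-- Terms equal to `false` drop out, so only the supports have to match. This collapses sums over all
-- edges or vertices to the few that contribute.
⨁-support : ∀ (f : A → Bool) {xs ys} → Unique xs → Unique ys →
            (∀ {x} → x ∈ xs → f x ≡ true → x ∈ ys) →
            (∀ {y} → y ∈ ys → f y ≡ true → y ∈ xs) → ⨁ xs f ≡ ⨁ ys f
⨁-support f {[]} {[]}     _ _ _ _ = refl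
⨁-support f {[]} {y ∷ ys} u (_ ∷ v) s t with f y in eq
... | true  = contradiction (t (here refl) eq) λ ()
... | false = ⨁-support f u v (λ ()) (t ∘ there)
⨁-support f {x ∷ xs} {ys} (x∉xs ∷ u) v s t with f x in eq
... | false = ⨁-support f u v (s ∘ there) λ y∈ys fy → tail (t y∈ys fy) fy
  where
  tail : ∀ {y} → y ∈ x ∷ xs → f y ≡ true → y ∈ xs
  tail (here refl) fy = contradiction (trans (sym eq) fy) λ ()
  tail (there p)   _  = p
... | true with zs , p , x∉zs ∷ v′ ← unique-extract (s (here refl) eq) v =
  trans (cong₂ _xor_ (sym eq) (⨁-support f u v′ s′ t′)) (sym (⨁-↭ f p))
  where
  s′ : ∀ {y} → y ∈ xs → f y ≡ true → y ∈ zs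
  s′ y∈xs fy with ∈-resp-↭ p (s (there y∈xs) fy)
  ... | here refl = contradiction refl (All.lookup x∉xs y∈xs)
  ... | there q   = q
  t′ : ∀ {y} → y ∈ zs → f y ≡ true → y ∈ xs
  t′ y∈zs fy with t (∈-resp-↭ (Perm.↭-sym p) (there y∈zs)) fy
  ... | there q   = q
  ... | here refl = contradiction refl (All.lookup x∉zs y∈zs)

-- An involution permutes a repetition-free list of the whole type.
⨁-reindex : ∀ {xs : List A} → Unique xs → (∀ x → x ∈ xs) →
            (σ : A → A) → (∀ x → σ (σ x) ≡ x) →
            (f : A → Bool) → ⨁ xs f ≡ ⨁ xs (f ∘ σ)
⨁-reindex {xs = xs} u all σ σσ f =
  trans (⨁-support f u (Uniqueₚ.map⁺ injective u)
           (λ {x} _ _ → subst (_∈ map σ xs) (σσ x) (∈-map⁺ σ (all (σ x))))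
           (λ {y} _ _ → all y))
        (⨁-map σ f xs)
  where
  injective : ∀ {x y} → σ x ≡ σ y → x ≡ y
  injective {x} {y} p = trans (sym (σσ x)) (trans (cong σ p) (σσ y))

-- Each entry of `xs` with positive weight is cancelled against its copy in `ys`. It serves to
-- compare a degree with the incidences of a chosen list of edges.
sum-support : ∀ (g : A → ℕ) {xs ys} → Unique xs → Unique ys →
              (∀ {x} → x ∈ xs → 1 ≤ g x → x ∈ ys) → sum (map g xs) ≤ sum (map g ys)
sum-support g {[]} _ _ _ = z≤n
sum-support g {x ∷ xs} {ys} (x∉xs ∷ u) v s with g x in eq
... | zero  = sum-support g u v (s ∘ there)
... | suc k with zs , p , _ ∷ v′ ← unique-extract (s (here refl) (≤-trans (s≤s z≤n) (≤-reflexive (sym eq)))) v =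
  ≤-trans (+-monoʳ-≤ (suc k) (sum-support g u v′ s′))
          (≤-reflexive (trans (cong (_+ sum (map g zs)) (sym eq)) (sym (sum-↭ (map⁺ g p)))))
  where
  s′ : ∀ {y} → y ∈ xs → 1 ≤ g y → y ∈ zs
  s′ y∈xs gy with ∈-resp-↭ p (s (there y∈xs) gy)
  ... | here refl = contradiction refl (All.lookup x∉xs y∈xs)
  ... | there q   = q

allVecs : ∀ n → List (Vec Bool n)
allVecs zero    = [] ∷ []
allVecs (suc n) = map (true ∷_) (allVecs n) ++ map (false ∷_) (allVecs n)

∈-allVecs : ∀ {n} (v : Vec Bool n) → v ∈ allVecs n
∈-allVecs []          = here refl
∈-allVecs (true  ∷ v) = ∈-++⁺ˡ (∈-map⁺ (true ∷_) (∈-allVecs v))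
∈-allVecs (false ∷ v) = ∈-++⁺ʳ _ (∈-map⁺ (false ∷_) (∈-allVecs v))

allVecs-unique : ∀ n → Unique (allVecs n)
allVecs-unique zero    = [] ∷ []
allVecs-unique (suc n) =
  Uniqueₚ.++⁺ (Uniqueₚ.map⁺ ∷-injectiveʳ (allVecs-unique n))
              (Uniqueₚ.map⁺ ∷-injectiveʳ (allVecs-unique n)) disjoint
  where
  disjoint : ∀ {v} → ¬ (v ∈ map (true ∷_) (allVecs n) × v ∈ map (false ∷_) (allVecs n))
  disjoint (p , q) with ∈-map⁻ (true ∷_) p | ∈-map⁻ (false ∷_) q
  ... | _ , _ , refl | _ , _ , ()

-- Pairing up the entries of a list of even length

module Pairing (_≟_ : DecidableEquality A) where

  partner : List A → A → A
  partner (x ∷ y ∷ l) z with z ≟ x | z ≟ y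
  ... | yes _ | _     = y
  ... | no  _ | yes _ = x
  ... | no  _ | no  _ = partner l z
  -- A leftover last entry, or an element that is not listed, would be a fixed point; `partner-spec`
  -- excludes both.
  partner _           z = z

  partner-head : ∀ x y l → partner (x ∷ y ∷ l) x ≡ y
  partner-head x y l with x ≟ x
  ... | yes _  = refl
  ... | no x≢x = contradiction refl x≢x

  partner-second : ∀ {x y} l → x ≢ y → partner (x ∷ y ∷ l) y ≡ x
  partner-second {x} {y} l x≢y with y ≟ x | y ≟ y
  ... | yes y≡x | _     = contradiction (sym y≡x) x≢y
  ... | no  _   | yes _ = refl
  ... | no  _   | no y≢y = contradiction refl y≢y

  partner-skip : ∀ {x y z} l → z ≢ x → z ≢ y → partner (x ∷ y ∷ l) z ≡ partner l z
  partner-skip {x} {y} {z} l z≢x z≢y with z ≟ x | z ≟ y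
  ... | yes p | _     = contradiction p z≢x
  ... | no  _ | yes p = contradiction p z≢y
  ... | no  _ | no  _ = refl

  partner-spec : ∀ {l} → Unique l → odd (length l) ≡ false → ∀ {z} → z ∈ l →
                 partner l z ∈ l × partner l (partner l z) ≡ z × partner l z ≢ z
  partner-spec {x ∷ y ∷ l} ((x≢y ∷ _) ∷ _) _ (here refl)
    rewrite partner-head x y l = there (here refl) , partner-second l x≢y , ≢-sym x≢y
  partner-spec {x ∷ y ∷ l} ((x≢y ∷ _) ∷ _) _ (there (here refl))
    rewrite partner-second l x≢y = here refl , partner-head x y l , x≢y
  partner-spec {x ∷ y ∷ l} ((_ ∷ x∉l) ∷ y∉l ∷ u) even {z} (there (there z∈l))
    with p , q , r ← partner-spec u (trans (sym (not-involutive _)) even) z∈l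
    rewrite partner-skip l (≢-sym (All.lookup x∉l z∈l)) (≢-sym (All.lookup y∉l z∈l)) =
    there (there p) ,
    trans (partner-skip l (≢-sym (All.lookup x∉l p)) (≢-sym (All.lookup y∉l p))) q , r

_⇔-dec_ : {A B : Set} → Dec A → Dec B → Dec (A ⇔ B)
a? ⇔-dec b? = map′ (λ (f , g) → mk⇔ f g) (λ h → Equivalence.to h , Equivalence.from h)
                   ((a? →-dec b?) ×-dec (b? →-dec a?))

-- Toggling one edge in an edge set

-- One operation for insertion and deletion: being an involution on all edge sets, it can re-index
-- sums.
flipAt : ∀ {m} → Fin m → Subset m → Subset m
flipAt e F = F [ e ]%= not

module _ {m : ℕ} where

  flipAt-involutive : ∀ e (F : Subset m) → flipAt e (flipAt e F) ≡ F
  flipAt-involutive e F =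
    trans (updateAt-updateAt-local e F (not-involutive (lookup F e))) (updateAt-id e F)

  ∉⇒false : ∀ {e} {F : Subset m} → e ∉ˢ F → lookup F e ≡ false
  ∉⇒false {e} {F} e∉F with lookup F e in eq
  ... | true  = contradiction (lookup⇒[]= e F eq) e∉F
  ... | false = refl

  ∉⇒∈-flipAt : ∀ {e} {F : Subset m} → e ∉ˢ F → e ∈ˢ flipAt e F
  ∉⇒∈-flipAt {e} {F} e∉F = updateAt-updates e F (lookup⇒[]= e F (∉⇒false e∉F))

  ∈⇒∉-flipAt : ∀ {e} {F : Subset m} → e ∈ˢ F → e ∉ˢ flipAt e F
  ∈⇒∉-flipAt {e} {F} e∈F e∈′ =
    contradiction (trans (sym ([]=⇒lookup e∈′)) ([]=⇒lookup (updateAt-updates e F e∈F))) λ ()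

  ∈-flipAt⇒∉ : ∀ {e} {F : Subset m} → e ∈ˢ flipAt e F → e ∉ˢ F
  ∈-flipAt⇒∉ e∈′ e∈F = ∈⇒∉-flipAt e∈F e∈′

  ∈⇒∈-flipAt : ∀ {e g} {F : Subset m} → g ≢ e → g ∈ˢ F → g ∈ˢ flipAt e F
  ∈⇒∈-flipAt {e} {g} {F} g≢e = updateAt-minimal g e F g≢e

  ∈-flipAt⇒∈ : ∀ {e g} {F : Subset m} → g ≢ e → g ∈ˢ flipAt e F → g ∈ˢ F
  ∈-flipAt⇒∈ {e} {g} {F} g≢e g∈ =
    subst (g ∈ˢ_) (flipAt-involutive e F) (∈⇒∈-flipAt g≢e g∈)

  ∈-flipAt⇒∈⊎≡ : ∀ {e g} {F : Subset m} → g ∈ˢ flipAt e F → g ∈ˢ F ⊎ g ≡ e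
  ∈-flipAt⇒∈⊎≡ {e} {g} g∈ with g ≟ e
  ... | yes g≡e = inj₂ g≡e
  ... | no  g≢e = inj₁ (∈-flipAt⇒∈ g≢e g∈)

  ∈⇒∈-flipAt⊎≡ : ∀ {e g} {F : Subset m} → g ∈ˢ F → g ∈ˢ flipAt e F ⊎ g ≡ e
  ∈⇒∈-flipAt⊎≡ {e} {g} g∈ with g ≟ e
  ... | yes g≡e = inj₂ g≡e
  ... | no  g≢e = inj₁ (∈⇒∈-flipAt g≢e g∈)

  remove≡flipAt : ∀ {e} {F : Subset m} → e ∈ˢ F → F [ e ]≔ false ≡ flipAt e F
  remove≡flipAt {e} {F} e∈F = updateAt-cong-local e F (cong not (sym ([]=⇒lookup e∈F)))

-- Walks and acyclicity under insertion and deletion of an edge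

module Walks (G : Graph) where

  private
    V = Vtx G
    E = Fin (m G)

  pairs : List (ESet G × ESet G)
  pairs = cartesianProduct (allVecs (m G)) (allVecs (m G))

  ∈-pairs : ∀ p → p ∈ pairs
  ∈-pairs (ψ , φ) = ∈-cartesianProduct⁺ (∈-allVecs ψ) (∈-allVecs φ)

  pairs-unique : Unique pairs
  pairs-unique = Uniqueₚ.cartesianProduct⁺ (allVecs-unique (m G)) (allVecs-unique (m G))

  src tgt : E → V
  src e = proj₁ (ends G e)
  tgt e = proj₂ (ends G e)

  joins : ∀ e → Joins G e (src e) (tgt e)
  joins e = inj₁ refl

  joins-sym : ∀ {e x y} → Joins G e x y → Joins G e y x
  joins-sym = Sum.swap

  joins-same : ∀ {e x y p q} → Joins G e x y → Joins G e p q → (x ≡ p × y ≡ q) ⊎ (x ≡ q × y ≡ p)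
  joins-same (inj₁ r) (inj₁ s) = inj₁ (,-injective (trans (sym r) s))
  joins-same (inj₁ r) (inj₂ s) = inj₂ (,-injective (trans (sym r) s))
  joins-same (inj₂ r) (inj₁ s) = inj₂ (Product.swap (,-injective (trans (sym r) s)))
  joins-same (inj₂ r) (inj₂ s) = inj₁ (Product.swap (,-injective (trans (sym r) s)))

  private variable
    F F′ : ESet G
    x y z : V

  walk-trans : Walk G F x y → Walk G F y z → Walk G F x z
  walk-trans here           w = w
  walk-trans (step e p j u) w = step e p j (walk-trans u w)

  walk-edge : ∀ {e} → e ∈ˢ F → Joins G e x y → Walk G F x y
  walk-edge p j = step _ p j here

  walk-sym : Walk G F x y → Walk G F y x
  walk-sym here           = here
  walk-sym (step e p j u) = walk-trans (walk-sym u) (walk-edge p (joins-sym j))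

  walk-mono : (∀ {g} → g ∈ˢ F → g ∈ˢ F′) → Walk G F x y → Walk G F′ x y
  walk-mono s here           = here
  walk-mono s (step e p j u) = step e (s p) j (walk-mono s u)

  -- A walk from `x` to `y` reduced to a single use of an edge between `p` and `q`; the two cases
  -- are the two directions of that use.
  Detour : ESet G → V → V → V → V → Set
  Detour F p q x y = (Walk G F x p × Walk G F q y) ⊎ (Walk G F x q × Walk G F p y)

  -- Several uses of `e` shrink to at most one: whenever the rest of the walk comes back to an end
  -- of `e`, the closed part in between is cut out. All comparisons of connectivity before and after
  -- a change of one edge go through this lemma.
  walk-add : ∀ {e p q} → (∀ {g} → g ∈ˢ F′ → g ∈ˢ F ⊎ g ≡ e) → Joins G e p q →
             Walk G F′ x y → Walk G F x y ⊎ Detour F p q x y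
  walk-add s j here = inj₁ here
  walk-add {F = F} s j (step g g∈ i u) with s g∈ | walk-add {F = F} s j u
  ... | inj₁ g∈F | inj₁ w                = inj₁ (step g g∈F i w)
  ... | inj₁ g∈F | inj₂ (inj₁ (w , w′))  = inj₂ (inj₁ (step g g∈F i w , w′))
  ... | inj₁ g∈F | inj₂ (inj₂ (w , w′))  = inj₂ (inj₂ (step g g∈F i w , w′))
  ... | inj₂ refl | r with joins-same i j
  walk-add s j (step g g∈ i u) | inj₂ refl | inj₁ w              | inj₁ (refl , refl) = inj₂ (inj₁ (here , w))
  walk-add s j (step g g∈ i u) | inj₂ refl | inj₂ (inj₁ (_ , w)) | inj₁ (refl , refl) = inj₂ (inj₁ (here , w))
  walk-add s j (step g g∈ i u) | inj₂ refl | inj₂ (inj₂ (_ , w)) | inj₁ (refl , refl) = inj₁ w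
  walk-add s j (step g g∈ i u) | inj₂ refl | inj₁ w              | inj₂ (refl , refl) = inj₂ (inj₂ (here , w))
  walk-add s j (step g g∈ i u) | inj₂ refl | inj₂ (inj₁ (_ , w)) | inj₂ (refl , refl) = inj₁ w
  walk-add s j (step g g∈ i u) | inj₂ refl | inj₂ (inj₂ (_ , w)) | inj₂ (refl , refl) = inj₂ (inj₂ (here , w))

  detour⇒walk : ∀ {e p q} → e ∈ˢ F → Joins G e p q → Detour F p q x y → Walk G F x y
  detour⇒walk e∈ j (inj₁ (u , w)) = walk-trans u (walk-trans (walk-edge e∈ j) w)
  detour⇒walk e∈ j (inj₂ (u , w)) = walk-trans u (walk-trans (walk-edge e∈ (joins-sym j)) w)

  detour-mono : ∀ {p q} → (∀ {g} → g ∈ˢ F → g ∈ˢ F′) → Detour F p q x y → Detour F′ p q x y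
  detour-mono s = Sum.map (λ (u , w) → walk-mono s u , walk-mono s w) (λ (u , w) → walk-mono s u , walk-mono s w)

  -- Recursion by deleting edges: by `walk-add`, a walk in `F` exists exactly when `F` without `e`
  -- has either a walk from `x` to `y` or the two pieces of a detour through `e`.
  walk?-within : (es : List E) (F : ESet G) → (∀ {g} → g ∈ˢ F → g ∈ es) →
                 ∀ x y → Dec (Walk G F x y)
  walk?-within [] F s x y = map′ (λ { refl → here }) trivial (x ≟ y)
    where
    trivial : Walk G F x y → x ≡ y
    trivial here           = refl
    trivial (step e p _ _) = contradiction (s p) λ ()
  walk?-within (e ∷ es) F s x y with e ∈ˢ? F
  ... | no e∉F = walk?-within es F s′ x y
    where
    s′ : ∀ {g} → g ∈ˢ F → g ∈ es
    s′ g∈ with s g∈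
    ... | here refl = contradiction g∈ e∉F
    ... | there p   = p
  ... | yes e∈F = map′ [ walk-mono H⊆F , detour⇒walk e∈F (joins e) ∘ detour-mono H⊆F ]′
                       (walk-add ∈⇒∈-flipAt⊎≡ (joins e))
                       (d x y ⊎-dec (d x (src e) ×-dec d (tgt e) y) ⊎-dec (d x (tgt e) ×-dec d (src e) y))
    where
    H = flipAt e F
    H⊆F : ∀ {g} → g ∈ˢ H → g ∈ˢ F
    H⊆F = [ id , (λ { refl → e∈F }) ]′ ∘ ∈-flipAt⇒∈⊎≡
    s′ : ∀ {g} → g ∈ˢ H → g ∈ es
    s′ g∈ with s (H⊆F g∈)
    ... | here refl = contradiction g∈ (∈⇒∉-flipAt e∈F)
    ... | there p   = p
    d : ∀ x y → Dec (Walk G H x y)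
    d = walk?-within es H s′

  abstract
    walk? : ∀ F x y → Dec (Walk G F x y)
    walk? F = walk?-within (allFin (m G)) F (λ {g} _ → ∈-allFin g)

  acyclic? : ∀ F → Dec (Acyclic G F)
  acyclic? F = all? λ e → (e ∈ˢ? F) →-dec ¬? (walk? (F [ e ]≔ false) (src e) (tgt e))

  acyclic-edge : ∀ {e} → Acyclic G F → e ∈ˢ F → Joins G e x y → ¬ Walk G (flipAt e F) x y
  acyclic-edge {F} {e = e} a e∈F j w with joins-same j (joins e)
  ... | inj₁ (refl , refl) = a e e∈F (subst (λ H → Walk G H _ _) (sym (remove≡flipAt e∈F)) w)
  ... | inj₂ (refl , refl) = a e e∈F (subst (λ H → Walk G H _ _) (sym (remove≡flipAt e∈F)) (walk-sym w))

  acyclic-intro : (∀ {e} → e ∈ˢ F → ¬ Walk G (flipAt e F) (src e) (tgt e)) → Acyclic G F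
  acyclic-intro h e e∈F w = h e∈F (subst (λ H → Walk G H _ _) (remove≡flipAt e∈F) w)

  acyclic-⊆ : (∀ {g} → g ∈ˢ F → g ∈ˢ F′) → Acyclic G F′ → Acyclic G F
  acyclic-⊆ {F} {F′} s a = acyclic-intro λ {e} e∈F w →
    acyclic-edge a (s e∈F) (joins e) (walk-mono (λ {g} g∈ → mono e e∈F g∈) w)
    where
    mono : ∀ e → e ∈ˢ F → ∀ {g} → g ∈ˢ flipAt e F → g ∈ˢ flipAt e F′
    mono e e∈F {g} g∈ with g ≟ e
    ... | yes refl = contradiction g∈ (∈⇒∉-flipAt e∈F)
    ... | no g≢e   = ∈⇒∈-flipAt g≢e (s (∈-flipAt⇒∈ g≢e g∈))

  -- A cycle through the new edge would join `p` to `q` in `F`. A cycle through an old edge `g`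
  -- either avoids `e` and lies in `F`, or uses `e`, and then the rest of it joins `p` to `q` in `F`
  -- by way of `g`.
  acyclic-add : ∀ {e p q} → Acyclic G F → e ∉ˢ F → Joins G e p q → ¬ Walk G F p q →
                Acyclic G (flipAt e F)
  acyclic-add {F} {e} {p} {q} a e∉F j ¬w = acyclic-intro bridge
    where
    bridge : ∀ {g} → g ∈ˢ flipAt e F → ¬ Walk G (flipAt g (flipAt e F)) (src g) (tgt g)
    bridge {g} g∈ w with g ≟ e
    ... | yes refl = oriented (joins-same j (joins e)) (subst (λ H → Walk G H _ _) (flipAt-involutive e F) w)
      where
      oriented : (p ≡ src e × q ≡ tgt e) ⊎ (p ≡ tgt e × q ≡ src e) → ¬ Walk G F (src e) (tgt e)
      oriented (inj₁ (refl , refl)) = ¬w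
      oriented (inj₂ (refl , refl)) = ¬w ∘ walk-sym
    ... | no g≢e = cases (walk-add s j w)
      where
      g∈F : g ∈ˢ F
      g∈F = ∈-flipAt⇒∈ g≢e g∈
      ⊆F : ∀ {h} → h ∈ˢ flipAt g F → h ∈ˢ F
      ⊆F = [ id , (λ { refl → g∈F }) ]′ ∘ ∈-flipAt⇒∈⊎≡
      s : ∀ {h} → h ∈ˢ flipAt g (flipAt e F) → h ∈ˢ flipAt g F ⊎ h ≡ e
      s {h} h∈ with h ≟ e | h ≟ g
      ... | yes h≡e | _        = inj₂ h≡e
      ... | no  h≢e | yes refl = contradiction h∈ (∈⇒∉-flipAt g∈)
      ... | no  h≢e | no h≢g   = inj₁ (∈⇒∈-flipAt h≢g (∈-flipAt⇒∈ h≢e (∈-flipAt⇒∈ h≢g h∈)))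
      cases : ¬ (Walk G (flipAt g F) (src g) (tgt g) ⊎ Detour (flipAt g F) p q (src g) (tgt g))
      cases (inj₁ w) = acyclic-edge a g∈F (joins g) w
      cases (inj₂ (inj₁ (u , w))) =
        ¬w (walk-trans (walk-sym (walk-mono ⊆F u)) (walk-trans (walk-edge g∈F (joins g)) (walk-sym (walk-mono ⊆F w))))
      cases (inj₂ (inj₂ (u , w))) =
        ¬w (walk-trans (walk-mono ⊆F w) (walk-trans (walk-edge g∈F (joins-sym (joins g))) (walk-mono ⊆F u)))

-- Pairs of a tree and a forest, and exchange along crossing edges

module Configurations (G : Graph) (U : Vtx G → Set) (U? : Decidable U) where

  open Walks G

  private
    V = Vtx G
    E = Fin (m G)

  private variable
    F ψ φ : ESet G
    x y z : V

  sep : ESet G → V → V → Bool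
  sep F x y = not (does (walk? F x y))

  sep-walk : Walk G F x y → sep F x y ≡ false
  sep-walk {F} {x} {y} w = cong not (dec-true (walk? F x y) w)

  sep-¬walk : ¬ Walk G F x y → sep F x y ≡ true
  sep-¬walk {F} {x} {y} w = cong not (dec-false (walk? F x y) w)

  -- The pigeonhole form of having at most two components. It names no representatives, so it is
  -- decided by running over vertices and does not depend on which trees an exchange creates.
  AtMostTwoTrees : ESet G → Set
  AtMostTwoTrees F = ∀ x y z → U x → U y → U z → Walk G F x y ⊎ Walk G F y z ⊎ Walk G F x z

  -- Over F₂, having at most two components makes sep additive along paths.
  sep-xor : AtMostTwoTrees F → U x → U y → U z → sep F x z ≡ sep F x y xor sep F y z
  sep-xor {F} {x} {y} {z} t ux uy uz with walk? F x y | walk? F y z | walk? F x z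
  ... | yes p | yes q | yes r = refl
  ... | yes p | yes q | no ¬r = contradiction (walk-trans p q) ¬r
  ... | yes p | no ¬q | yes r = contradiction (walk-trans (walk-sym p) r) ¬q
  ... | yes p | no ¬q | no ¬r = refl
  ... | no ¬p | yes q | yes r = contradiction (walk-trans r (walk-sym q)) ¬p
  ... | no ¬p | yes q | no ¬r = refl
  ... | no ¬p | no ¬q | yes r = refl
  ... | no ¬p | no ¬q | no ¬r with t x y z ux uy uz
  ... | inj₁ p        = contradiction p ¬p
  ... | inj₂ (inj₁ q) = contradiction q ¬q
  ... | inj₂ (inj₂ r) = contradiction r ¬r

  twoTrees-cover : ∀ {p q} → (∀ {x} → U x → Walk G F x p ⊎ Walk G F x q) → AtMostTwoTrees F
  twoTrees-cover c x y z ux uy uz with c ux | c uy | c uz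
  ... | inj₁ p | inj₁ q | _      = inj₁ (walk-trans p (walk-sym q))
  ... | inj₂ p | inj₂ q | _      = inj₁ (walk-trans p (walk-sym q))
  ... | inj₁ p | inj₂ q | inj₁ r = inj₂ (inj₂ (walk-trans p (walk-sym r)))
  ... | inj₁ p | inj₂ q | inj₂ r = inj₂ (inj₁ (walk-trans q (walk-sym r)))
  ... | inj₂ p | inj₁ q | inj₁ r = inj₂ (inj₁ (walk-trans q (walk-sym r)))
  ... | inj₂ p | inj₁ q | inj₂ r = inj₂ (inj₂ (walk-trans p (walk-sym r)))

  Inner : E → Set
  Inner e = U (src e) × U (tgt e)

  inner-ends : ∀ {e} → Inner e → Joins G e x y → U x × U y
  inner-ends {e = e} i j with joins-same j (joins e)
  ... | inj₁ (refl , refl) = i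
  ... | inj₂ (refl , refl) = Product.swap i

  Bipartition : ESet G × ESet G → Set
  Bipartition (ψ , φ) = ∀ e → ((e ∈ˢ ψ ⊎ e ∈ˢ φ) ⇔ Inner e) × ¬ (e ∈ˢ ψ × e ∈ˢ φ)

  Spans : ESet G → Set
  Spans ψ = ∀ x y → U x → U y → Walk G ψ x y

  -- φ may be connected; then it separates nothing, so such pairs do not contribute to the sums.
  Config : ESet G × ESet G → Set
  Config p@(ψ , φ) =
    Bipartition p × Spans ψ × Acyclic G ψ × Acyclic G φ × AtMostTwoTrees φ

  abstract
    config? : Decidable Config
    config? (ψ , φ) =
      all? (λ e → (((e ∈ˢ? ψ) ⊎-dec (e ∈ˢ? φ)) ⇔-dec (U? (src e) ×-dec U? (tgt e)))
                  ×-dec ¬? ((e ∈ˢ? ψ) ×-dec (e ∈ˢ? φ)))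
      ×-dec all? (λ x → all? λ y → U? x →-dec U? y →-dec walk? ψ x y)
      ×-dec acyclic? ψ
      ×-dec acyclic? φ
      ×-dec all? (λ x → all? λ y → all? λ z → U? x →-dec U? y →-dec U? z →-dec
                    (walk? φ x y ⊎-dec walk? φ y z ⊎-dec walk? φ x z))

  -- Cut a walk from a vertex to `src f` at `f`: it either avoids `f` or has a beginning that avoids
  -- `f` and stops at an end of `f`.
  tree-remove : ∀ {f} → Spans ψ → Inner f → AtMostTwoTrees (flipAt f ψ)
  tree-remove {ψ} {f} sp (us , ut) = twoTrees-cover reach
    where
    reach : ∀ {x} → U x → Walk G (flipAt f ψ) x (src f) ⊎ Walk G (flipAt f ψ) x (tgt f)
    reach {x} ux with walk-add ∈⇒∈-flipAt⊎≡ (joins f) (sp x (src f) ux us)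
    ... | inj₁ w              = inj₁ w
    ... | inj₂ (inj₁ (w , _)) = inj₁ w
    ... | inj₂ (inj₂ (w , _)) = inj₂ w

  Crossing : E → ESet G × ESet G → Set
  Crossing f p@(ψ , φ) = Config p × f ∈ˢ ψ × ¬ Walk G φ (src f) (tgt f)

  crossing? : ∀ f p → Dec (Crossing f p)
  crossing? f p@(ψ , φ) = config? p ×-dec (f ∈ˢ? ψ) ×-dec ¬? (walk? φ (src f) (tgt f))

  exchange : E → ESet G × ESet G → ESet G × ESet G
  exchange f (ψ , φ) = flipAt f φ , flipAt f ψ

  exchange-involutive : ∀ f p → exchange f (exchange f p) ≡ p
  exchange-involutive f (ψ , φ) = cong₂ _,_ (flipAt-involutive f ψ) (flipAt-involutive f φ)

  -- Since `f` runs between the two trees of `φ`, adding it makes `φ` a spanning tree. Deleting it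
  -- from the tree `ψ` disconnects its ends, so `f` is again a crossing edge and can be exchanged
  -- back.
  exchange-crossing : ∀ f p → Crossing f p → Crossing f (exchange f p)
  exchange-crossing f (ψ , φ) ((bp , sp , aψ , aφ , two) , f∈ψ , ¬w) =
    (bp′ , sp′ , acyclic-add aφ f∉φ (joins f) ¬w , acyclic-⊆ ⊆ψ aψ , tree-remove sp inner)
    , ∉⇒∈-flipAt f∉φ , acyclic-edge aψ f∈ψ (joins f)
    where
    f∉φ : f ∉ˢ φ
    f∉φ f∈φ = proj₂ (bp f) (f∈ψ , f∈φ)
    inner : Inner f
    inner = Equivalence.to (proj₁ (bp f)) (inj₁ f∈ψ)
    ⊆ψ : ∀ {g} → g ∈ˢ flipAt f ψ → g ∈ˢ ψ
    ⊆ψ = [ id , (λ { refl → f∈ψ }) ]′ ∘ ∈-flipAt⇒∈⊎≡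
    bp′ : Bipartition (flipAt f φ , flipAt f ψ)
    bp′ e with e ≟ f
    ... | yes refl = mk⇔ (λ _ → inner) (λ _ → inj₁ (∉⇒∈-flipAt f∉φ)) , ∈⇒∉-flipAt f∈ψ ∘ proj₂
    ... | no e≢f   =
      mk⇔ (Equivalence.to (proj₁ (bp e)) ∘ Sum.swap ∘ Sum.map (∈-flipAt⇒∈ e≢f) (∈-flipAt⇒∈ e≢f))
          (Sum.map (∈⇒∈-flipAt e≢f) (∈⇒∈-flipAt e≢f) ∘ Sum.swap ∘ Equivalence.from (proj₁ (bp e)))
      , λ (p , q) → proj₂ (bp e) (∈-flipAt⇒∈ e≢f q , ∈-flipAt⇒∈ e≢f p)
    φ⊆ : ∀ {g} → g ∈ˢ φ → g ∈ˢ flipAt f φ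
    φ⊆ {g} g∈φ with g ≟ f
    ... | yes refl = contradiction g∈φ f∉φ
    ... | no g≢f   = ∈⇒∈-flipAt g≢f g∈φ
    toSrc : ∀ {x} → U x → Walk G (flipAt f φ) x (src f)
    toSrc {x} ux with two x (src f) (tgt f) ux (proj₁ inner) (proj₂ inner)
    ... | inj₁ w        = walk-mono φ⊆ w
    ... | inj₂ (inj₁ w) = contradiction w ¬w
    ... | inj₂ (inj₂ w) =
      walk-trans (walk-mono φ⊆ w) (walk-edge (∉⇒∈-flipAt f∉φ) (joins-sym {f} (joins f)))
    sp′ : Spans (flipAt f φ)
    sp′ x y ux uy = walk-trans (toSrc ux) (walk-sym (toSrc uy))

  -- Edges of `φ` never cross, so in a configuration the edges of `ψ` account for the whole cut. The
  -- conjunction is the computed truth value of the last two parts of `crossing?`.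
  crosses : ESet G × ESet G → E → Bool
  crosses (ψ , φ) f = does (f ∈ˢ? ψ) ∧ sep φ (src f) (tgt f)

  -- The f with sep (flipAt f ψ) x y are the edges of the ψ-path from x to y.
  path-parity : Config (ψ , φ) → Walk G ψ x y → U x → U y →
                ⨁ (allFin (m G)) (λ f → crosses (ψ , φ) f ∧ sep (flipAt f ψ) x y) ≡ sep φ x y
  path-parity {ψ} {φ} {x} c here ux uy = begin
    ⨁ (allFin (m G)) (λ f → crosses (ψ , φ) f ∧ sep (flipAt f ψ) x x)
      ≡⟨ ⨁-cong (allFin (m G)) (λ f → trans (cong (crosses (ψ , φ) f ∧_) (sep-walk here)) (∧-zeroʳ _)) ⟩
    ⨁ (allFin (m G)) (λ _ → false) ≡⟨ ⨁-false (allFin (m G)) ⟩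
    false                          ≡⟨ sep-walk here ⟨
    sep φ x x                      ∎
    where open ≡-Reasoning
  path-parity {ψ} {φ} {x} {y} c@(bp , sp , aψ , aφ , two) (step {y = x′} e e∈ψ j u) ux uy = begin
    -- Both sides are additive in the end vertices, so the induction may follow any walk, simple or
    -- not. Only the single step along `e` has to be counted: deleting an edge other than `e` leaves
    -- its ends joined, and deleting `e` separates them because `ψ` is acyclic.
    ⨁ fs (term x y)                            ≡⟨ ⨁-cong fs additive ⟩
    ⨁ fs (λ f → term x x′ f xor term x′ y f)   ≡⟨ ⨁-xor fs (term x x′) (term x′ y) ⟩
    ⨁ fs (term x x′) xor ⨁ fs (term x′ y)      ≡⟨ cong₂ _xor_ single (path-parity c u ux′ uy) ⟩
    sep φ x x′ xor sep φ x′ y                  ≡⟨ sep-xor two ux ux′ uy ⟨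
    sep φ x y                                  ∎
    where
    open ≡-Reasoning
    fs = allFin (m G)
    term : V → V → E → Bool
    term x y f = crosses (ψ , φ) f ∧ sep (flipAt f ψ) x y
    inner : ∀ {f} → f ∈ˢ ψ → Inner f
    inner f∈ψ = Equivalence.to (proj₁ (bp _)) (inj₁ f∈ψ)
    ux′ : U x′
    ux′ = proj₂ (inner-ends (inner e∈ψ) j)
    additive : ∀ f → term x y f ≡ term x x′ f xor term x′ y f
    additive f with f ∈ˢ? ψ
    ... | no _    = refl
    ... | yes f∈ψ =
      trans (cong (sep φ (src f) (tgt f) ∧_) (sep-xor (tree-remove sp (inner f∈ψ)) ux ux′ uy))
            (∧-distribˡ-xor (sep φ (src f) (tgt f)) _ _)
    only-e : ∀ {f} → f ∈ fs → term x x′ f ≡ true → f ∈ (e ∷ [])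
    only-e {f} _ t with f ≟ e
    ... | yes refl = here refl
    ... | no f≢e   = contradiction (trans (sym t) (trans (cong (crosses (ψ , φ) f ∧_)
                       (sep-walk (walk-edge (∈⇒∈-flipAt (≢-sym f≢e) e∈ψ) j))) (∧-zeroʳ _))) λ ()
    oriented : sep φ (src e) (tgt e) ≡ sep φ x x′
    oriented with joins-same j (joins e)
    ... | inj₁ (refl , refl) = refl
    ... | inj₂ (refl , refl) = cong not (does-⇔ (mk⇔ walk-sym walk-sym) (walk? φ _ _) (walk? φ _ _))
    single : ⨁ fs (term x x′) ≡ sep φ x x′
    single = begin
      ⨁ fs (term x x′)
        ≡⟨ ⨁-support (term x x′) (Uniqueₚ.allFin⁺ (m G)) ([] ∷ []) only-e (λ {f} _ _ → ∈-allFin f) ⟩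
      term x x′ e xor false  ≡⟨ xor-identityʳ _ ⟩
      (does (e ∈ˢ? ψ) ∧ sep φ (src e) (tgt e)) ∧ sep (flipAt e ψ) x x′
        ≡⟨ cong₂ (λ s t → (s ∧ sep φ (src e) (tgt e)) ∧ t) (dec-true (e ∈ˢ? ψ) e∈ψ) (sep-¬walk (acyclic-edge aψ e∈ψ j)) ⟩
      sep φ (src e) (tgt e) ∧ true ≡⟨ ∧-comm _ true ⟩
      sep φ (src e) (tgt e)  ≡⟨ oriented ⟩
      sep φ x x′             ∎

  cutParity : ESet G × ESet G → Bool
  cutParity p = ⨁ (allFin (m G)) (crosses p)

  -- Modulo 2 the factor `not (cutParity p)` is k + 1; `doubleCount` makes the k cancel the 1.
  even-cuts-even : U x → U y →
    ⨁ pairs (λ p → does (config? p) ∧ (sep (proj₂ p) x y ∧ not (cutParity p))) ≡ false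
  even-cuts-even {x} {y} ux uy = begin
    ⨁ pairs (λ p → K p ∧ (s p ∧ not (cutParity p)))       ≡⟨ ⨁-cong pairs (λ p → expand (K p) (s p) (cutParity p)) ⟩
    ⨁ pairs (λ p → (K p ∧ s p) xor ((K p ∧ s p) ∧ cutParity p)) ≡⟨ ⨁-xor pairs _ _ ⟩
    ⨁ pairs (λ p → K p ∧ s p) xor ⨁ pairs (λ p → (K p ∧ s p) ∧ cutParity p)
      ≡⟨ cong (⨁ pairs (λ p → K p ∧ s p) xor_) doubleCount ⟩
    ⨁ pairs (λ p → K p ∧ s p) xor ⨁ pairs (λ p → K p ∧ s p) ≡⟨ xor-same (⨁ pairs (λ p → K p ∧ s p)) ⟩
    false ∎
    where
    open ≡-Reasoning
    fs = allFin (m G)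
    K s : ESet G × ESet G → Bool
    K p = does (config? p)
    s p = sep (proj₂ p) x y
    onPath : ESet G × ESet G → E → Bool
    onPath p f = sep (flipAt f (proj₁ p)) x y
    expand : ∀ a b c → a ∧ (b ∧ not c) ≡ (a ∧ b) xor ((a ∧ b) ∧ c)
    expand false b     c = refl
    expand true  false c = refl
    expand true  true  c = refl
    rotate : ∀ a b c → (a ∧ b) ∧ c ≡ (a ∧ c) ∧ b
    rotate a b c = trans (∧-assoc a b c) (trans (cong (a ∧_) (∧-comm b c)) (sym (∧-assoc a c b)))
    exchanged : ∀ f p → let q = exchange f p in
                (K q ∧ s q) ∧ crosses q f ≡ K p ∧ (crosses p f ∧ onPath p f)
    exchanged f p = let q = exchange f p in begin
      (K q ∧ s q) ∧ crosses q f ≡⟨ rotate (K q) (s q) _ ⟩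
      -- The bracket computes to the truth value of `crossing? f q`, and exchanging twice gives the
      -- converse implication.
      (K q ∧ crosses q f) ∧ s q ≡⟨ cong (_∧ s q) (does-⇔ (mk⇔ back (exchange-crossing f p)) (crossing? f q) (crossing? f p)) ⟩
      -- The forest of `q` is `ψ` with `f` toggled, so `s q` computes to `onPath p f`.
      (K p ∧ crosses p f) ∧ s q ≡⟨ ∧-assoc (K p) _ _ ⟩
      K p ∧ (crosses p f ∧ onPath p f) ∎
      where
      back : Crossing f (exchange f p) → Crossing f p
      back c = subst (Crossing f) (exchange-involutive f p) (exchange-crossing f _ c)
    onPath-parity : ∀ p → K p ∧ ⨁ fs (λ f → crosses p f ∧ onPath p f) ≡ K p ∧ s p
    onPath-parity p with config? p
    ... | no _  = refl
    ... | yes c@(_ , sp , _) = path-parity c (sp x y ux uy) ux uy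
    doubleCount : ⨁ pairs (λ p → (K p ∧ s p) ∧ cutParity p) ≡ ⨁ pairs (λ p → K p ∧ s p)
    doubleCount = begin
      ⨁ pairs (λ p → (K p ∧ s p) ∧ cutParity p)
        ≡⟨ ⨁-cong pairs (λ p → ⨁-∧ˡ fs (K p ∧ s p) (crosses p)) ⟨
      ⨁ pairs (λ p → ⨁ fs (λ f → (K p ∧ s p) ∧ crosses p f))
        -- With `f` outermost, the exchange along `f` is one fixed involution of the index set of
        -- the inner sum.
        ≡⟨ ⨁-swap pairs fs _ ⟩
      ⨁ fs (λ f → ⨁ pairs (λ p → (K p ∧ s p) ∧ crosses p f))
        ≡⟨ ⨁-cong fs (λ f → trans (⨁-reindex pairs-unique ∈-pairs (exchange f) (exchange-involutive f) _)
                                  (⨁-cong pairs (exchanged f))) ⟩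
      ⨁ fs (λ f → ⨁ pairs (λ p → K p ∧ (crosses p f ∧ onPath p f)))
        ≡⟨ ⨁-swap pairs fs _ ⟨
      ⨁ pairs (λ p → ⨁ fs (λ f → K p ∧ (crosses p f ∧ onPath p f)))
        ≡⟨ ⨁-cong pairs (λ p → trans (⨁-∧ˡ fs (K p) _) (onPath-parity p)) ⟩
      ⨁ pairs (λ p → K p ∧ s p) ∎

-- Decidability of membership in the sets of bipartitions

module _ (G : Graph) (v w : Vtx G) where

  open Walks G
  open DecMembership (_≟_ {n G}) using (_∈?_)

  vertS? : Decidable (VertS G v w)
  vertS? x = ¬? (x ≟ v) ×-dec ¬? (x ≟ w)

  abstract
    inSP? : ∀ P₁ P₂ → Decidable (InSP G v w P₁ P₂)
    inSP? P₁ P₂ (ψ , φ) =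
      all? (λ e → (((e ∈ˢ? ψ) ⊎-dec (e ∈ˢ? φ)) ⇔-dec (vertS? (src e) ×-dec vertS? (tgt e)))
                  ×-dec ¬? ((e ∈ˢ? ψ) ×-dec (e ∈ˢ? φ)))
      ×-dec (acyclic? ψ ×-dec all? (λ x → all? λ y → vertS? x →-dec vertS? y →-dec walk? ψ x y))
      ×-dec acyclic? φ
      ×-dec all? (λ x → all? λ y → (x ∈? P₁) →-dec (y ∈? P₁) →-dec walk? φ x y)
      ×-dec all? (λ x → all? λ y → (x ∈? P₂) →-dec (y ∈? P₂) →-dec walk? φ x y)
      ×-dec all? (λ x → all? λ y → (x ∈? P₁) →-dec (y ∈? P₂) →-dec ¬? (walk? φ x y))
      ×-dec all? (λ x → vertS? x →-dec any? λ p → (p ∈? (P₁ ++ P₂)) ×-dec walk? φ x p)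

-- Deleting the leaf c

VertS₀ : (G : Graph) (v w c : Vtx G) → Vtx G → Set
VertS₀ G v w c x = VertS G v w x × x ≢ c

module LeafRemoval (G : Graph) (v w c : Vtx G) (c-vert : VertS G v w c) where

  open Walks G

  U : Vtx G → Set
  U = VertS₀ G v w c

  abstract
    U? : Decidable U
    U? x = vertS? G v w x ×-dec ¬? (x ≟ c)

  open Configurations G U U? public

  private
    V = Vtx G
    E = Fin (m G)

  private variable
    F F′ : ESet G
    x y z : V

  inner-avoids : ∀ {e} → Inner e → ¬ Joins G e c y
  inner-avoids i j = proj₂ (proj₁ (inner-ends i j)) refl

  first-edge : c ≢ z → Walk G F c z → ∃ λ g → g ∈ˢ F × ∃ λ y → Joins G g c y
  first-edge c≢z here            = contradiction refl c≢z
  first-edge c≢z (step g g∈ j _) = g , g∈ , _ , j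

  isolated : (∀ {g} → g ∈ˢ F → Inner g) → Walk G F c z → z ≡ c
  isolated i here            = refl
  isolated i (step g g∈ j _) = contradiction j (inner-avoids (i g∈))

  module _ {e} (s : ∀ {g} → g ∈ˢ F′ → g ∈ˢ F ⊎ g ≡ e) (i : ∀ {g} → g ∈ˢ F → Inner g)
           (j : Joins G e c y) where

    -- The vertex `c` is isolated in `F`, and `e` hangs at `c`: a detour through `e` would join `c`
    -- to another vertex inside `F`.
    leaf-walk : x ≢ c → z ≢ c → Walk G F′ x z → Walk G F x z
    leaf-walk x≢c z≢c u with walk-add s j u
    ... | inj₁ u′             = u′
    ... | inj₂ (inj₁ (p , _)) = contradiction (isolated i (walk-sym p)) x≢c
    ... | inj₂ (inj₂ (_ , q)) = contradiction (isolated i q) z≢c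

    leaf-end : x ≢ c → Walk G F′ x c → Walk G F x y
    leaf-end x≢c u with walk-add s j u
    ... | inj₁ u′             = contradiction (isolated i (walk-sym u′)) x≢c
    ... | inj₂ (inj₁ (p , _)) = contradiction (isolated i (walk-sym p)) x≢c
    ... | inj₂ (inj₂ (p , _)) = p

  -- The edges at `c` in S. They may be parallel, so the edges are required to differ but not their
  -- far ends.
  record Star (e₁ e₂ : E) (y₁ y₂ : V) : Set where
    field
      e₁≢e₂ : e₁ ≢ e₂
      j₁    : Joins G e₁ c y₁
      j₂    : Joins G e₂ c y₂
      u₁    : U y₁
      u₂    : U y₂
      split : ∀ {f} → EdgeS G v w f → Inner f ⊎ f ≡ e₁ ⊎ f ≡ e₂

  star-sym : ∀ {e₁ e₂ y₁ y₂} → Star e₁ e₂ y₁ y₂ → Star e₂ e₁ y₂ y₁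
  star-sym S = record
    { e₁≢e₂ = ≢-sym e₁≢e₂ ; j₁ = j₂ ; j₂ = j₁ ; u₁ = u₂ ; u₂ = u₁
    ; split = Sum.map₂ Sum.swap ∘ split }
    where open Star S

  -- What compatibility with the singleton side `x` becomes on S - c: the demand that `c` lie with
  -- the `o`s turns into the demand that `y`, the neighbour of `c` in the forest, does.
  Alone : V → V → V → V → V → ESet G → Set
  Alone x o₁ o₂ o₃ y φ = Walk G φ o₁ o₂ × Walk G φ o₁ o₃ × Walk G φ o₁ y × ¬ Walk G φ x o₁

  alone? : ∀ x o₁ o₂ o₃ y → Decidable (Alone x o₁ o₂ o₃ y)
  alone? x o₁ o₂ o₃ y φ = walk? φ o₁ o₂ ×-dec walk? φ o₁ o₃ ×-dec walk? φ o₁ y ×-dec ¬? (walk? φ x o₁)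

  -- The permutation lets one argument serve all four sets, whose lists hold `c` at different
  -- places.
  module _ {x o₁ o₂ o₃ : V} (ux : U x) (uo₁ : U o₁) (uo₂ : U o₂) (uo₃ : U o₃) (P₂ : List V)
           (P₂↭ : P₂ ↭ o₁ ∷ o₂ ∷ o₃ ∷ c ∷ []) where

    private
      SP : ESet G × ESet G → Set
      SP = InSP G v w (x ∷ []) P₂
      o₁∈ : o₁ ∈ P₂
      o₁∈ = ∈-resp-↭ (↭-sym P₂↭) (here refl)
      o₂∈ : o₂ ∈ P₂
      o₂∈ = ∈-resp-↭ (↭-sym P₂↭) (there (here refl))
      o₃∈ : o₃ ∈ P₂
      o₃∈ = ∈-resp-↭ (↭-sym P₂↭) (there (there (here refl)))
      c∈ : c ∈ P₂
      c∈ = ∈-resp-↭ (↭-sym P₂↭) (there (there (there (here refl))))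

    module _ {e₁ e₂ y₁ y₂} (S : Star e₁ e₂ y₁ y₂) where

      open Star S

      edgeS : ∀ {f} → Inner f → EdgeS G v w f
      edgeS ((p , _) , (q , _)) = p , q

      star-edgeS : ∀ {e y} → Joins G e c y → U y → EdgeS G v w e
      star-edgeS {e} j uy with joins-same j (joins e)
      ... | inj₁ (refl , refl) = c-vert , proj₁ uy
      ... | inj₂ (refl , refl) = proj₁ uy , c-vert

      at-c : ∀ {f y} → EdgeS G v w f → Joins G f c y → f ≡ e₁ ⊎ f ≡ e₂
      at-c s j with split s
      ... | inj₁ i = contradiction j (inner-avoids i)
      ... | inj₂ r = r

      -- Both `ψ` and `φ` join `c` to `o₁`, so each has an edge at `c`. There are only two such
      -- edges, and the parts are disjoint.
      inSP-choice : ∀ {ψ φ} → SP (ψ , φ) → (e₁ ∈ˢ ψ × e₂ ∈ˢ φ) ⊎ (e₂ ∈ˢ ψ × e₁ ∈ˢ φ)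
      inSP-choice {ψ} {φ} (bp , (_ , sp) , (_ , _ , w₂ , _))
        with first-edge (≢-sym (proj₂ uo₁)) (sp c o₁ c-vert (proj₁ uo₁))
           | first-edge (≢-sym (proj₂ uo₁)) (w₂ c o₁ c∈ o₁∈)
      ... | g , g∈ψ , _ , i | h , h∈φ , _ , j
        with at-c (Equivalence.to (proj₁ (bp g)) (inj₁ g∈ψ)) i
           | at-c (Equivalence.to (proj₁ (bp h)) (inj₂ h∈φ)) j
      ... | inj₁ refl | inj₁ refl = contradiction (g∈ψ , h∈φ) (proj₂ (bp e₁))
      ... | inj₁ refl | inj₂ refl = inj₁ (g∈ψ , h∈φ)
      ... | inj₂ refl | inj₁ refl = inj₂ (g∈ψ , h∈φ)
      ... | inj₂ refl | inj₂ refl = contradiction (g∈ψ , h∈φ) (proj₂ (bp e₂))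

      attach : ESet G × ESet G → ESet G × ESet G
      attach (ψ , φ) = flipAt e₁ ψ , flipAt e₂ φ

      attach-involutive : ∀ p → attach (attach p) ≡ p
      attach-involutive (ψ , φ) = cong₂ _,_ (flipAt-involutive e₁ ψ) (flipAt-involutive e₂ φ)

      -- With `e₁` in `ψ`, the edge `e₂` is the only one of the forest at `c`. Walks between other
      -- vertices survive the deletion of `c` by `leaf-walk`, and a walk to `c` must come through
      -- `y₂`.
      detach-config : ∀ p → SP (attach p) × e₁ ∈ˢ proj₁ (attach p) →
                      Config p × Alone x o₁ o₂ o₃ y₂ (proj₂ p)
      detach-config (ψ , φ) (sp@(bp , (aψ , spans) , aφ , _ , w₂ , sep₁₂ , cover) , e₁∈ψ′) =
        (bp₀ , spans₀ , acyclic-⊆ ψ⊆ aψ , acyclic-⊆ φ⊆ aφ , twoTrees-cover cover₀)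
        , inφ uo₁ uo₂ (w₂ _ _ o₁∈ o₂∈)
        , inφ uo₁ uo₃ (w₂ _ _ o₁∈ o₃∈)
        , leaf-end ∈-flipAt⇒∈⊎≡ innerφ j₂ (proj₂ uo₁) (w₂ _ _ o₁∈ c∈)
        , λ u → sep₁₂ x o₁ (here refl) o₁∈ (walk-mono φ⊆ u)
        where
        e₂∈φ′ : e₂ ∈ˢ flipAt e₂ φ
        e₂∈φ′ with inSP-choice sp
        ... | inj₁ (_ , p) = p
        ... | inj₂ (_ , p) = contradiction (e₁∈ψ′ , p) (proj₂ (bp e₁))
        e₁∉ψ : e₁ ∉ˢ ψ
        e₁∉ψ = ∈-flipAt⇒∉ e₁∈ψ′
        e₂∉φ : e₂ ∉ˢ φ
        e₂∉φ = ∈-flipAt⇒∉ e₂∈φ′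
        ψ⊆ : ∀ {g} → g ∈ˢ ψ → g ∈ˢ flipAt e₁ ψ
        ψ⊆ {g} g∈ with g ≟ e₁
        ... | yes refl = contradiction g∈ e₁∉ψ
        ... | no g≢e   = ∈⇒∈-flipAt g≢e g∈
        φ⊆ : ∀ {g} → g ∈ˢ φ → g ∈ˢ flipAt e₂ φ
        φ⊆ {g} g∈ with g ≟ e₂
        ... | yes refl = contradiction g∈ e₂∉φ
        ... | no g≢e   = ∈⇒∈-flipAt g≢e g∈
        innerψ : ∀ {g} → g ∈ˢ ψ → Inner g
        innerψ {g} g∈ with split (Equivalence.to (proj₁ (bp g)) (inj₁ (ψ⊆ g∈)))
        ... | inj₁ i           = i
        ... | inj₂ (inj₁ refl) = contradiction g∈ e₁∉ψ
        ... | inj₂ (inj₂ refl) = contradiction (ψ⊆ g∈ , e₂∈φ′) (proj₂ (bp e₂))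
        innerφ : ∀ {g} → g ∈ˢ φ → Inner g
        innerφ {g} g∈ with split (Equivalence.to (proj₁ (bp g)) (inj₂ (φ⊆ g∈)))
        ... | inj₁ i           = i
        ... | inj₂ (inj₁ refl) = contradiction (e₁∈ψ′ , φ⊆ g∈) (proj₂ (bp e₁))
        ... | inj₂ (inj₂ refl) = contradiction g∈ e₂∉φ
        bp₀ : Bipartition (ψ , φ)
        bp₀ f = mk⇔ [ innerψ , innerφ ]′ back , λ (p , q) → proj₂ (bp f) (ψ⊆ p , φ⊆ q)
          where
          back : Inner f → f ∈ˢ ψ ⊎ f ∈ˢ φ
          back i = Sum.map (∈-flipAt⇒∈ λ { refl → inner-avoids i j₁ })
                           (∈-flipAt⇒∈ λ { refl → inner-avoids i j₂ })
                           (Equivalence.from (proj₁ (bp f)) (edgeS i))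
        spans₀ : Spans ψ
        spans₀ p q up uq =
          leaf-walk ∈-flipAt⇒∈⊎≡ innerψ j₁ (proj₂ up) (proj₂ uq) (spans p q (proj₁ up) (proj₁ uq))
        inφ : ∀ {p q} → U p → U q → Walk G (flipAt e₂ φ) p q → Walk G φ p q
        inφ up uq = leaf-walk ∈-flipAt⇒∈⊎≡ innerφ j₂ (proj₂ up) (proj₂ uq)
        cover₀ : ∀ {p} → U p → Walk G φ p x ⊎ Walk G φ p o₁
        cover₀ {p} up with cover p (proj₁ up)
        ... | q , q∈ , u with ∈-++⁻ (x ∷ []) q∈
        ... | inj₁ (here refl) = inj₁ (inφ up ux u)
        ... | inj₂ q∈P₂        = inj₂ (inφ up uo₁ (walk-trans u (w₂ q o₁ q∈P₂ o₁∈)))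

      attach-config : ∀ p → Config p × Alone x o₁ o₂ o₃ y₂ (proj₂ p) →
                      SP (attach p) × e₁ ∈ˢ proj₁ (attach p)
      attach-config (ψ , φ) ((bp , spans , aψ , aφ , two) , o₁₂ , o₁₃ , o₁y , x≁o₁) =
        ( bp′
        , (acyclic-add aψ e₁∉ψ j₁ (isolate innerψ u₁) , spans′)
        , acyclic-add aφ e₂∉φ j₂ (isolate innerφ u₂)
        , (λ { _ _ (here refl) (here refl) → here })
        , (λ p q p∈ q∈ → walk-trans (to-o₁ p∈) (walk-sym (to-o₁ q∈)))
        , (λ { _ q (here refl) q∈ u → x≁o₁ (leaf-walk ∈-flipAt⇒∈⊎≡ innerφ j₂ (proj₂ ux) (proj₂ uo₁) (walk-trans u (to-o₁ q∈))) })
        , cover ) , e₁∈ψ′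
        where
        innerψ : ∀ {g} → g ∈ˢ ψ → Inner g
        innerψ {g} g∈ = Equivalence.to (proj₁ (bp g)) (inj₁ g∈)
        innerφ : ∀ {g} → g ∈ˢ φ → Inner g
        innerφ {g} g∈ = Equivalence.to (proj₁ (bp g)) (inj₂ g∈)
        isolate : ∀ {F y} → (∀ {g} → g ∈ˢ F → Inner g) → U y → ¬ Walk G F c y
        isolate i uy u = proj₂ uy (isolated i u)
        e₁∉ψ : e₁ ∉ˢ ψ
        e₁∉ψ p = inner-avoids (innerψ p) j₁
        e₁∉φ : e₁ ∉ˢ φ
        e₁∉φ p = inner-avoids (innerφ p) j₁
        e₂∉ψ : e₂ ∉ˢ ψ
        e₂∉ψ p = inner-avoids (innerψ p) j₂
        e₂∉φ : e₂ ∉ˢ φ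
        e₂∉φ p = inner-avoids (innerφ p) j₂
        e₁∈ψ′ : e₁ ∈ˢ flipAt e₁ ψ
        e₁∈ψ′ = ∉⇒∈-flipAt e₁∉ψ
        e₂∈φ′ : e₂ ∈ˢ flipAt e₂ φ
        e₂∈φ′ = ∉⇒∈-flipAt e₂∉φ
        ψ⊆ : ∀ {g} → g ∈ˢ ψ → g ∈ˢ flipAt e₁ ψ
        ψ⊆ g∈ = ∈⇒∈-flipAt (λ { refl → e₁∉ψ g∈ }) g∈
        φ⊆ : ∀ {g} → g ∈ˢ φ → g ∈ˢ flipAt e₂ φ
        φ⊆ g∈ = ∈⇒∈-flipAt (λ { refl → e₂∉φ g∈ }) g∈
        bp′ : EdgeBipartition G v w (flipAt e₁ ψ) (flipAt e₂ φ)
        bp′ f = mk⇔ to′ from′ , disjoint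
          where
          to′ : f ∈ˢ flipAt e₁ ψ ⊎ f ∈ˢ flipAt e₂ φ → EdgeS G v w f
          to′ (inj₁ p) with ∈-flipAt⇒∈⊎≡ p
          ... | inj₁ f∈ψ  = edgeS (innerψ f∈ψ)
          ... | inj₂ refl = star-edgeS j₁ u₁
          to′ (inj₂ p) with ∈-flipAt⇒∈⊎≡ p
          ... | inj₁ f∈φ  = edgeS (innerφ f∈φ)
          ... | inj₂ refl = star-edgeS j₂ u₂
          from′ : EdgeS G v w f → f ∈ˢ flipAt e₁ ψ ⊎ f ∈ˢ flipAt e₂ φ
          from′ s with split s
          ... | inj₁ i           = Sum.map ψ⊆ φ⊆ (Equivalence.from (proj₁ (bp f)) i)
          ... | inj₂ (inj₁ refl) = inj₁ e₁∈ψ′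
          ... | inj₂ (inj₂ refl) = inj₂ e₂∈φ′
          disjoint : ¬ (f ∈ˢ flipAt e₁ ψ × f ∈ˢ flipAt e₂ φ)
          disjoint (p , q) with ∈-flipAt⇒∈⊎≡ p | ∈-flipAt⇒∈⊎≡ q
          ... | inj₁ p′   | inj₁ q′   = proj₂ (bp f) (p′ , q′)
          ... | inj₁ p′   | inj₂ refl = e₂∉ψ p′
          ... | inj₂ refl | inj₁ q′   = e₁∉φ q′
          ... | inj₂ refl | inj₂ r    = e₁≢e₂ r
        to-y₁ : ∀ {p} → VertS G v w p → Walk G (flipAt e₁ ψ) p y₁
        to-y₁ {p} vp with p ≟ c
        ... | yes refl = walk-edge e₁∈ψ′ j₁
        ... | no p≢c   = walk-mono ψ⊆ (spans p y₁ (vp , p≢c) u₁)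
        spans′ : ∀ p q → VertS G v w p → VertS G v w q → Walk G (flipAt e₁ ψ) p q
        spans′ p q vp vq = walk-trans (to-y₁ vp) (walk-sym (to-y₁ vq))
        to-o₁ : ∀ {p} → p ∈ P₂ → Walk G (flipAt e₂ φ) p o₁
        to-o₁ {p} p∈ with ∈-resp-↭ P₂↭ p∈
        ... | here refl                         = here
        ... | there (here refl)                 = walk-sym (walk-mono φ⊆ o₁₂)
        ... | there (there (here refl))         = walk-sym (walk-mono φ⊆ o₁₃)
        ... | there (there (there (here refl))) =
          walk-trans (walk-edge e₂∈φ′ j₂) (walk-sym (walk-mono φ⊆ o₁y))
        cover : ∀ p → VertS G v w p → ∃ λ q → q ∈ (x ∷ P₂) × Walk G (flipAt e₂ φ) p q
        cover p vp with p ≟ c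
        ... | yes refl = c , there c∈ , here
        ... | no p≢c with two p x o₁ (vp , p≢c) ux uo₁
        ... | inj₁ u        = x , here refl , walk-mono φ⊆ u
        ... | inj₂ (inj₁ u) = contradiction u x≁o₁
        ... | inj₂ (inj₂ u) = o₁ , there o₁∈ , walk-mono φ⊆ u

      -- Fixing `e₁` in the tree puts `e₂` in the forest, which is why `y₂` and not `y₁` appears on
      -- the right.
      choice-sum : ⨁ pairs (λ p → does (inSP? G v w (x ∷ []) P₂ p) ∧ does (e₁ ∈ˢ? proj₁ p)) ≡
                   ⨁ pairs (λ p → does (config? p) ∧ does (alone? x o₁ o₂ o₃ y₂ (proj₂ p)))
      choice-sum =
        trans (⨁-reindex pairs-unique ∈-pairs attach attach-involutive _)
              (⨁-cong pairs λ p → does-⇔ (mk⇔ (detach-config p) (attach-config p))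
                (inSP? G v w (x ∷ []) P₂ (attach p) ×-dec (e₁ ∈ˢ? proj₁ (attach p)))
                (config? p ×-dec alone? x o₁ o₂ o₃ y₂ (proj₂ p)))

    inSP-sum : ∀ {e₁ e₂ y₁ y₂} → Star e₁ e₂ y₁ y₂ →
               ⨁ pairs (λ p → does (inSP? G v w (x ∷ []) P₂ p)) ≡
               ⨁ pairs (λ p → does (config? p) ∧ (does (alone? x o₁ o₂ o₃ y₂ (proj₂ p)) xor
                                                  does (alone? x o₁ o₂ o₃ y₁ (proj₂ p))))
    inSP-sum {e₁} {e₂} {y₁} {y₂} S = begin
      ⨁ pairs I                                                   ≡⟨ ⨁-cong pairs one-choice ⟩
      ⨁ pairs (λ p → (I p ∧ does (e₁ ∈ˢ? proj₁ p)) xor (I p ∧ does (e₂ ∈ˢ? proj₁ p)))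
        ≡⟨ ⨁-xor pairs _ _ ⟩
      ⨁ pairs (λ p → I p ∧ does (e₁ ∈ˢ? proj₁ p)) xor ⨁ pairs (λ p → I p ∧ does (e₂ ∈ˢ? proj₁ p))
        ≡⟨ cong₂ _xor_ (choice-sum S) (choice-sum (star-sym S)) ⟩
      ⨁ pairs (λ p → K p ∧ T y₂ p) xor ⨁ pairs (λ p → K p ∧ T y₁ p)
        ≡⟨ ⨁-xor pairs _ _ ⟨
      ⨁ pairs (λ p → (K p ∧ T y₂ p) xor (K p ∧ T y₁ p))
        ≡⟨ ⨁-cong pairs (λ p → ∧-distribˡ-xor (K p) (T y₂ p) (T y₁ p)) ⟨
      ⨁ pairs (λ p → K p ∧ (T y₂ p xor T y₁ p))                   ∎
      where
      open ≡-Reasoning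
      I K : ESet G × ESet G → Bool
      I p = does (inSP? G v w (x ∷ []) P₂ p)
      K p = does (config? p)
      T : V → ESet G × ESet G → Bool
      T y p = does (alone? x o₁ o₂ o₃ y (proj₂ p))
      one-choice : ∀ p → I p ≡ (I p ∧ does (e₁ ∈ˢ? proj₁ p)) xor (I p ∧ does (e₂ ∈ˢ? proj₁ p))
      one-choice p@(ψ , φ) with inSP? G v w (x ∷ []) P₂ p
      ... | no _ = refl
      ... | yes sp@(bp , _) with inSP-choice S sp
      ... | inj₁ (e₁∈ψ , e₂∈φ) = sym (cong₂ _xor_ (dec-true (e₁ ∈ˢ? ψ) e₁∈ψ)
                                  (dec-false (e₂ ∈ˢ? ψ) λ e₂∈ψ → proj₂ (bp e₂) (e₂∈ψ , e₂∈φ)))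
      ... | inj₂ (e₂∈ψ , e₁∈φ) = sym (cong₂ _xor_ (dec-false (e₁ ∈ˢ? ψ) λ e₁∈ψ → proj₂ (bp e₁) (e₁∈ψ , e₁∈φ))
                                  (dec-true (e₂ ∈ˢ? ψ) e₂∈ψ))

-- Degree counts and the handshake lemma

module Degrees (G : Graph) where

  open Walks G
  open DecMembership (_≟_ {m G}) using (_∈?_)

  private
    V = Vtx G
    E = Fin (m G)
    fs = allFin (m G)

  private variable
    x y z p q : V
    f g : E

  joins-other : Joins G f x y → Joins G f x z → y ≡ z
  joins-other i j with joins-same i j
  ... | inj₁ (_ , r)    = r
  ... | inj₂ (r , refl) = r

  joins-distinct : Joins G f x y → Joins G g p q → x ≢ p → x ≢ q → f ≢ g
  joins-distinct i j x≢p x≢q refl with joins-same i j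
  ... | inj₁ (x≡p , _) = x≢p x≡p
  ... | inj₂ (x≡q , _) = x≢q x≡q

  -- The summand of `deg` in the same form, so that `deg G x` unfolds to its sum over all edges; a
  -- loop weighs 2.
  incidence : V → E → ℕ
  incidence x f = (if ⌊ src f ≟ x ⌋ then 1 else 0) + (if ⌊ tgt f ≟ x ⌋ then 1 else 0)

  joins⇒incident : Joins G f x y → 1 ≤ incidence x f
  joins⇒incident {f} {x} j with joins-same j (joins f)
  joins⇒incident {f} {x} j | inj₁ (x≡ , _) with src f ≟ x
  ... | yes _ = s≤s z≤n
  ... | no ¬p = contradiction (sym x≡) ¬p
  joins⇒incident {f} {x} j | inj₂ (x≡ , _) with tgt f ≟ x
  ... | yes _ = m≤n+m 1 _
  ... | no ¬p = contradiction (sym x≡) ¬p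

  incident⇒joins : ∀ x f → 1 ≤ incidence x f → ∃ λ y → Joins G f x y
  incident⇒joins x f i with src f ≟ x | tgt f ≟ x
  ... | yes refl | _        = tgt f , joins f
  ... | no _     | yes refl = src f , joins-sym {f} (joins f)
  incident⇒joins x f () | no _ | no _

  nonloop-incidence : Joins G f x y → x ≢ y → incidence x f ≡ 1
  nonloop-incidence {f} {x} j x≢y with joins-same j (joins f) | src f ≟ x | tgt f ≟ x
  ... | inj₁ (_ , refl) | _        | yes p = contradiction (sym p) x≢y
  ... | inj₁ (_ , _)    | yes _    | no _  = refl
  ... | inj₁ (p , _)    | no ¬p    | no _  = contradiction (sym p) ¬p
  ... | inj₂ (_ , refl) | yes p    | _     = contradiction (sym p) x≢y
  ... | inj₂ (_ , _)    | no _     | yes _ = refl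
  ... | inj₂ (p , _)    | no _     | no ¬p = contradiction (sym p) ¬p

  length≤sum : ∀ (g : E → ℕ) es → (∀ {f} → f ∈ es → 1 ≤ g f) → length es ≤ sum (map g es)
  length≤sum g []       h = z≤n
  length≤sum g (e ∷ es) h = +-mono-≤ (h (here refl)) (length≤sum g es (h ∘ there))

  -- Each listed edge contributes at least 1, so one more incident edge would exceed the degree.
  star-complete : ∀ {es} → Unique es → (∀ {f} → f ∈ es → 1 ≤ incidence x f) →
                  deg G x ≤ length es → 1 ≤ incidence x f → f ∈ es
  star-complete {x} {f} {es} u h d i with f ∈? es
  ... | yes f∈ = f∈
  ... | no f∉  = contradiction d (<⇒≱ (≤-trans (length≤sum (incidence x) (f ∷ es) h′) sum≤deg))
    where
    h′ : ∀ {g} → g ∈ f ∷ es → 1 ≤ incidence x g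
    h′ (here refl) = i
    h′ (there p)   = h p
    sum≤deg : sum (map (incidence x) (f ∷ es)) ≤ deg G x
    sum≤deg = sum-support (incidence x) (¬Any⇒All¬ es f∉ ∷ u) (Uniqueₚ.allFin⁺ (m G))
                (λ {g} _ _ → ∈-allFin g)

  -- The bound is on incidences and not on the number of edges, because a loop takes up two
  -- edge-ends.
  star-extend : ∀ {es} → Unique es → sum (map (incidence x) es) < deg G x →
                ∃ λ f → f ∉ es × ∃ λ y → Joins G f x y
  star-extend {x} {es} u lt with any? (λ f → ¬? (f ∈? es) ×-dec (1 ≤? incidence x f))
  ... | yes (f , f∉ , i) = f , f∉ , incident⇒joins x f i
  ... | no none = contradiction deg≤sum (<⇒≱ lt)
    where
    absorbed : ∀ {f} → f ∈ fs → 1 ≤ incidence x f → f ∈ es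
    absorbed {f} _ i with f ∈? es
    ... | yes f∈ = f∈
    ... | no f∉  = contradiction (f , f∉ , i) none
    deg≤sum : deg G x ≤ sum (map (incidence x) es)
    deg≤sum = sum-support (incidence x) (Uniqueₚ.allFin⁺ (m G)) u absorbed

  odd-incidence : ∀ x f → odd (incidence x f) ≡ does (src f ≟ x) xor does (tgt f ≟ x)
  odd-incidence x f with src f ≟ x | tgt f ≟ x
  ... | yes _ | yes _ = refl
  ... | yes _ | no _  = refl
  ... | no _  | yes _ = refl
  ... | no _  | no _  = refl

  ⨁-at : ∀ (s : V → Bool) u → ⨁ (allFin (n G)) (λ x → s x ∧ does (u ≟ x)) ≡ s u
  ⨁-at s u = begin
    ⨁ (allFin (n G)) δ  ≡⟨ ⨁-support δ (Uniqueₚ.allFin⁺ (n G)) ([] ∷ []) only-u (λ {x} _ _ → ∈-allFin x) ⟩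
    δ u xor false       ≡⟨ xor-identityʳ _ ⟩
    s u ∧ does (u ≟ u)  ≡⟨ cong (s u ∧_) (dec-true (u ≟ u) refl) ⟩
    s u ∧ true          ≡⟨ ∧-identityʳ (s u) ⟩
    s u                 ∎
    where
    open ≡-Reasoning
    δ : V → Bool
    δ x = s x ∧ does (u ≟ x)
    only-u : ∀ {x} → x ∈ allFin (n G) → δ x ≡ true → x ∈ (u ∷ [])
    only-u {x} _ t with u ≟ x
    ... | yes refl = here refl
    ... | no _     = contradiction (trans (sym t) (∧-zeroʳ (s x))) λ ()

  -- Exchanging the sums over edges and vertices gives `s x` the coefficient `odd (deg G x)`, which
  -- vanishes.
  handshake : (∀ x → odd (deg G x) ≡ false) → ∀ (s : V → Bool) →
              ⨁ fs (λ f → s (src f) xor s (tgt f)) ≡ false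
  handshake even s = begin
    ⨁ fs (λ f → s (src f) xor s (tgt f))
      ≡⟨ ⨁-cong fs (λ f → sym (expand f)) ⟩
    ⨁ fs (λ f → ⨁ vs (λ x → s x ∧ odd (incidence x f)))
      ≡⟨ ⨁-swap fs vs _ ⟩
    ⨁ vs (λ x → ⨁ fs (λ f → s x ∧ odd (incidence x f)))
      ≡⟨ ⨁-cong vs (λ x → trans (⨁-∧ˡ fs (s x) _) (trans (cong (s x ∧_)
           (trans (sym (odd-sum (incidence x) fs)) (even x))) (∧-zeroʳ (s x)))) ⟩
    ⨁ vs (λ _ → false) ≡⟨ ⨁-false vs ⟩
    false ∎
    where
    open ≡-Reasoning
    vs = allFin (n G)
    expand : ∀ f → ⨁ vs (λ x → s x ∧ odd (incidence x f)) ≡ s (src f) xor s (tgt f)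
    expand f = begin
      ⨁ vs (λ x → s x ∧ odd (incidence x f))
        ≡⟨ ⨁-cong vs (λ x → trans (cong (s x ∧_) (odd-incidence x f)) (∧-distribˡ-xor (s x) _ _)) ⟩
      ⨁ vs (λ x → (s x ∧ does (src f ≟ x)) xor (s x ∧ does (tgt f ≟ x)))
        ≡⟨ ⨁-xor vs _ _ ⟩
      ⨁ vs (λ x → s x ∧ does (src f ≟ x)) xor ⨁ vs (λ x → s x ∧ does (tgt f ≟ x))
        ≡⟨ cong₂ _xor_ (⨁-at s (src f)) (⨁-at s (tgt f)) ⟩
      s (src f) xor s (tgt f) ∎

  -- Distinct neighbours need distinct edges, and four of them exhaust the degree. Hence there is
  -- neither a loop at `x` nor a second edge to any of the four.
  four-star : ∀ {x p q r s fp fq fr fs} → deg G x ≡ 4 → Unique (x ∷ p ∷ q ∷ r ∷ s ∷ []) →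
              Joins G fp x p → Joins G fq x q → Joins G fr x r → Joins G fs x s →
              Joins G f x z → f ∈ (fp ∷ fq ∷ fr ∷ fs ∷ [])
  four-star {x = x} {fp = fp} {fq} {fr} {fs} deg-x
            ((x≢p ∷ x≢q ∷ x≢r ∷ _) ∷ (p≢q ∷ p≢r ∷ p≢s ∷ []) ∷ (q≢r ∷ q≢s ∷ []) ∷ (r≢s ∷ []) ∷ _)
            jp jq jr js j =
    star-complete unique incident (≤-reflexive deg-x) (joins⇒incident j)
    where
    apart : ∀ {g h y z} → Joins G g x y → Joins G h x z → x ≢ y → y ≢ z → g ≢ h
    apart i j x≢y y≢z = joins-distinct (joins-sym i) j (≢-sym x≢y) y≢z
    unique : Unique (fp ∷ fq ∷ fr ∷ fs ∷ [])
    unique = (apart jp jq x≢p p≢q ∷ apart jp jr x≢p p≢r ∷ apart jp js x≢p p≢s ∷ [])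
           ∷ (apart jq jr x≢q q≢r ∷ apart jq js x≢q q≢s ∷ [])
           ∷ (apart jr js x≢r r≢s ∷ []) ∷ [] ∷ []
    incident : ∀ {g} → g ∈ (fp ∷ fq ∷ fr ∷ fs ∷ []) → 1 ≤ incidence x g
    incident (here refl)                         = joins⇒incident jp
    incident (there (here refl))                 = joins⇒incident jq
    incident (there (there (here refl)))         = joins⇒incident jr
    incident (there (there (there (here refl)))) = joins⇒incident js

-- Truth table of odd splits, and passage from parity to enumerations

∀-bool? : {P : Bool → Set} → (∀ b → Dec (P b)) → Dec (∀ b → P b)
∀-bool? P? = map′ (λ { (p , q) true → p ; (p , q) false → q }) (λ h → h true , h false)
                  (P? true ×-dec P? false)

-- `Alone` read off a 2-colouring of the vertices, in which equal colours mean the same tree.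
aloneᵇ : Bool → Bool → Bool → Bool → Bool → Bool
aloneᵇ x o₁ o₂ o₃ y = not (o₁ xor o₂) ∧ (not (o₁ xor o₃) ∧ (not (o₁ xor y) ∧ (x xor o₁)))

-- An odd split of {a,b,d,e} has a unique minority element, and c can be attached to the majority
-- tree through exactly one of y₁, y₂ precisely when these are separated.
alone-parity : ∀ a b d e y₁ y₂ →
  (aloneᵇ a b d e y₂ xor aloneᵇ a b d e y₁) xor ((aloneᵇ b a d e y₂ xor aloneᵇ b a d e y₁) xor
  ((aloneᵇ d a b e y₂ xor aloneᵇ d a b e y₁) xor (aloneᵇ e a b d y₂ xor aloneᵇ e a b d y₁)))
  ≡ (y₁ xor y₂) ∧ not (a xor (b xor (d xor (e xor (y₁ xor y₂)))))
alone-parity = toWitness {a? = ∀-bool? λ a → ∀-bool? λ b → ∀-bool? λ d → ∀-bool? λ e →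
                               ∀-bool? λ y₁ → ∀-bool? λ y₂ → _ Bool.≟ _} _

does-⊎-disjoint : {A B : Set} (a? : Dec A) (b? : Dec B) → ¬ (A × B) →
                  does (a? ⊎-dec b?) ≡ does a? xor does b?
does-⊎-disjoint (yes p) (yes q) h = contradiction (p , q) h
does-⊎-disjoint (yes p) (no _)  h = refl
does-⊎-disjoint (no _)  b?      h = refl

enumerates-parity : {A : Set} {P : A → Set} {xs L : List A} → Unique xs → (∀ x → x ∈ xs) →
                    (P? : Decidable P) → Enumerates P L → odd (length L) ≡ ⨁ xs (does ∘ P?)
enumerates-parity {P = P} {xs} {L} u all P? (uL , L⇔P) = begin
  odd (length L)      ≡⟨ ⨁-true L (does ∘ P?) (λ {x} x∈L → dec-true (P? x) (Equivalence.to (L⇔P x) x∈L)) ⟨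
  ⨁ L (does ∘ P?)     ≡⟨ ⨁-support (does ∘ P?) u uL listed (λ {x} _ _ → all x) ⟨
  ⨁ xs (does ∘ P?)    ∎
  where
  open ≡-Reasoning
  listed : ∀ {x} → x ∈ xs → does (P? x) ≡ true → x ∈ L
  listed {x} _ t with P? x
  ... | yes px = Equivalence.from (L⇔P x) px

-- Elements of `Σ A P` carry a proof that their first component need not determine, so the equations
-- are about first components.
even-enumerable⇒involution : {A : Set} {P : A → Set} {L : List A} → DecidableEquality A →
  Enumerates P L → odd (length L) ≡ false →
  ∃ λ (ι : Σ A P → Σ A P) → (∀ x → proj₁ (ι (ι x)) ≡ proj₁ x) × (∀ x → proj₁ (ι x) ≢ proj₁ x)
even-enumerable⇒involution {A} {P} {L} _≟ᴬ_ (u , L⇔P) even =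
  (λ (x , px) → partner L x , Equivalence.to (L⇔P _) (proj₁ (spec px)))
  , (λ (x , px) → proj₁ (proj₂ (spec px)))
  , (λ (x , px) → proj₂ (proj₂ (spec px)))
  where
  open Pairing _≟ᴬ_
  spec : ∀ {x} → P x → partner L x ∈ L × partner L (partner L x) ≡ x × partner L x ≢ x
  spec {x} px = partner-spec u even (Equivalence.from (L⇔P x) px)

-- The forest has `y` and `c` in one tree by the first membership and in different trees by the
-- second.
inSP-disjoint : ∀ G (v w : Vtx G) {x y c P Q} → y ∈ P → c ∈ P → c ∈ Q →
                ∀ {p} → InSP G v w (x ∷ []) P p → ¬ InSP G v w (y ∷ []) Q p
inSP-disjoint G v w {y = y} {c} y∈P c∈P c∈Q (_ , _ , _ , _ , joined , _) (_ , _ , _ , _ , _ , apart , _) =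
  apart y c (here refl) c∈Q (joined y c y∈P c∈P)

-- A loop of S would lie in `ψ` or `φ` and be a cycle there. This settles the case of a loop at `c`.
inSP-no-loop : ∀ G (v w : Vtx G) {x f P Q p} → VertS G v w x → Joins G f x x → ¬ InSP G v w P Q p
inSP-no-loop G v w {x} {f} {p = ψ , φ} vx j (bp , (aψ , _) , aφ , _)
  with Equivalence.from (proj₁ (bp f)) (edgeS j)
  where
  edgeS : Joins G f x x → EdgeS G v w f
  edgeS (inj₁ r) = subst (VertS G v w) (sym (cong proj₁ r)) vx , subst (VertS G v w) (sym (cong proj₂ r)) vx
  edgeS (inj₂ r) = subst (VertS G v w) (sym (cong proj₁ r)) vx , subst (VertS G v w) (sym (cong proj₂ r)) vx
... | inj₁ f∈ψ = Walks.acyclic-edge G aψ f∈ψ j here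
... | inj₂ f∈φ = Walks.acyclic-edge G aφ f∈φ j here

-- The surroundings of v, w and c

module Neighbourhood
  (G : Graph) (deg4 : ∀ x → deg G x ≡ 4) (v w a b c d e : Vtx G)
  (v≢w : v ≢ w) (c-vert : VertS G v w c) (a≢b : a ≢ b) (d≢e : d ≢ e)
  (ua : VertS₀ G v w c a) (ub : VertS₀ G v w c b) (ud : VertS₀ G v w c d) (ue : VertS₀ G v w c e)
  (adj-w : ∀ y → y ∈ (v ∷ a ∷ b ∷ c ∷ []) → Adj G w y)
  (adj-v : ∀ y → y ∈ (w ∷ c ∷ d ∷ e ∷ []) → Adj G v y) where

  open LeafRemoval G v w c c-vert
  open Walks G
  open Degrees G

  private
    V = Vtx G
    E = Fin (m G)

    wv : Adj G w v
    wv = adj-w v (here refl)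
    wa : Adj G w a
    wa = adj-w a (there (here refl))
    wb : Adj G w b
    wb = adj-w b (there (there (here refl)))
    wc : Adj G w c
    wc = adj-w c (there (there (there (here refl))))
    vw : Adj G v w
    vw = adj-v w (here refl)
    vc : Adj G v c
    vc = adj-v c (there (here refl))
    vd : Adj G v d
    vd = adj-v d (there (there (here refl)))
    ve : Adj G v e
    ve = adj-v e (there (there (there (here refl))))

    w≢ : ∀ {x} → U x → w ≢ x
    w≢ ((_ , x≢w) , _) = ≢-sym x≢w
    v≢ : ∀ {x} → U x → v ≢ x
    v≢ ((x≢v , _) , _) = ≢-sym x≢v
    c≢ : ∀ {x} → U x → c ≢ x
    c≢ (_ , x≢c) = ≢-sym x≢c
    w≢c : w ≢ c
    w≢c = ≢-sym (proj₂ c-vert)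
    v≢c : v ≢ c
    v≢c = ≢-sym (proj₁ c-vert)

  w-star : ∀ {f z} → Joins G f w z → z ≢ v → (f ≡ proj₁ wa × z ≡ a) ⊎ (f ≡ proj₁ wb × z ≡ b) ⊎ (f ≡ proj₁ wc × z ≡ c)
  w-star {f} {z} j z≢v with four-star (deg4 w)
    ((≢-sym v≢w ∷ w≢ ua ∷ w≢ ub ∷ w≢c ∷ []) ∷ (v≢ ua ∷ v≢ ub ∷ v≢c ∷ []) ∷ (a≢b ∷ ≢-sym (c≢ ua) ∷ []) ∷ (≢-sym (c≢ ub) ∷ []) ∷ [] ∷ [])
    (proj₂ wv) (proj₂ wa) (proj₂ wb) (proj₂ wc) j
  ... | here refl                         = contradiction (joins-other j (proj₂ wv)) z≢v
  ... | there (here refl)                 = inj₁ (refl , joins-other j (proj₂ wa))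
  ... | there (there (here refl))         = inj₂ (inj₁ (refl , joins-other j (proj₂ wb)))
  ... | there (there (there (here refl))) = inj₂ (inj₂ (refl , joins-other j (proj₂ wc)))

  v-star : ∀ {f z} → Joins G f v z → z ≢ w → (f ≡ proj₁ vc × z ≡ c) ⊎ (f ≡ proj₁ vd × z ≡ d) ⊎ (f ≡ proj₁ ve × z ≡ e)
  v-star {f} {z} j z≢w with four-star (deg4 v)
    ((v≢w ∷ v≢c ∷ v≢ ud ∷ v≢ ue ∷ []) ∷ (w≢c ∷ w≢ ud ∷ w≢ ue ∷ []) ∷ (c≢ ud ∷ c≢ ue ∷ []) ∷ (d≢e ∷ []) ∷ [] ∷ [])
    (proj₂ vw) (proj₂ vc) (proj₂ vd) (proj₂ ve) j
  ... | here refl                         = contradiction (joins-other j (proj₂ vw)) z≢w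
  ... | there (here refl)                 = inj₁ (refl , joins-other j (proj₂ vc))
  ... | there (there (here refl))         = inj₂ (inj₁ (refl , joins-other j (proj₂ vd)))
  ... | there (there (there (here refl))) = inj₂ (inj₂ (refl , joins-other j (proj₂ ve)))

  CompleteStar : E → E → V → V → Set
  CompleteStar e₁ e₂ y₁ y₂ = Star e₁ e₂ y₁ y₂ × (∀ {f z} → Joins G f c z → U z → f ≡ e₁ ⊎ f ≡ e₂)

  -- The edges to `w` and `v` take two of the four edge-ends at `c`. The other two belong to one
  -- loop or to two further edges.
  loop-or-star : (∃ λ f → Joins G f c c) ⊎ (∃ λ e₁ → ∃ λ e₂ → ∃ λ y₁ → ∃ λ y₂ → CompleteStar e₁ e₂ y₁ y₂)
  loop-or-star = first (star-extend unique₀ (below es₀ sum₀ (s≤s (s≤s (s≤s z≤n)))))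
    where
    Result : Set
    Result = (∃ λ f → Joins G f c c) ⊎ (∃ λ e₁ → ∃ λ e₂ → ∃ λ y₁ → ∃ λ y₂ → CompleteStar e₁ e₂ y₁ y₂)
    es₀ : List E
    es₀ = proj₁ wc ∷ proj₁ vc ∷ []
    below : ∀ es {k} → sum (map (incidence c) es) ≡ k → k < 4 → sum (map (incidence c) es) < deg G c
    below _ s lt = subst₂ _<_ (sym s) (sym (deg4 c)) lt
    unique₀ : Unique es₀
    unique₀ = (joins-distinct (proj₂ wc) (proj₂ vc) (≢-sym v≢w) w≢c ∷ []) ∷ [] ∷ []
    sum₀ : sum (map (incidence c) es₀) ≡ 2
    sum₀ = cong₂ _+_ (nonloop-incidence (joins-sym (proj₂ wc)) (≢-sym w≢c))
                     (cong (_+ 0) (nonloop-incidence (joins-sym (proj₂ vc)) (≢-sym v≢c)))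
    fresh-end : ∀ {f y} → f ∉ es₀ → Joins G f c y → y ≢ c → U y
    fresh-end {f} {y} f∉ j y≢c = (y≢v , y≢w) , y≢c
      where
      -- By `v-star` and `w-star`, each of `v` and `w` has a single edge to `c`, and it is already
      -- in `es₀`.
      y≢v : y ≢ v
      y≢v refl with v-star (joins-sym j) (≢-sym w≢c)
      ... | inj₁ (r , _)        = f∉ (there (here r))
      ... | inj₂ (inj₁ (_ , r)) = c≢ ud r
      ... | inj₂ (inj₂ (_ , r)) = c≢ ue r
      y≢w : y ≢ w
      y≢w refl with w-star (joins-sym j) (≢-sym v≢c)
      ... | inj₁ (_ , r)        = c≢ ua r
      ... | inj₂ (inj₁ (_ , r)) = c≢ ub r
      ... | inj₂ (inj₂ (r , _)) = f∉ (here r)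
    module _ {e₁ e₂ y₁ y₂} (e₁∉ : e₁ ∉ es₀) (e₂∉ : e₂ ∉ e₁ ∷ es₀)
             (j₁ : Joins G e₁ c y₁) (j₂ : Joins G e₂ c y₂) (y₁≢c : y₁ ≢ c) (y₂≢c : y₂ ≢ c) where
      es₂ : List E
      es₂ = e₂ ∷ e₁ ∷ es₀
      incident : ∀ {f} → f ∈ es₂ → 1 ≤ incidence c f
      incident (here refl)                         = joins⇒incident j₂
      incident (there (here refl))                 = joins⇒incident j₁
      incident (there (there (here refl)))         = joins⇒incident (joins-sym (proj₂ wc))
      incident (there (there (there (here refl)))) = joins⇒incident (joins-sym (proj₂ vc))
      ∈-es₂ : ∀ {f z} → Joins G f c z → f ∈ es₂
      ∈-es₂ j = star-complete (¬Any⇒All¬ _ e₂∉ ∷ ¬Any⇒All¬ _ e₁∉ ∷ unique₀) incident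
                             (≤-reflexive (deg4 c)) (joins⇒incident j)
      complete : ∀ {f z} → Joins G f c z → VertS G v w z → f ≡ e₁ ⊎ f ≡ e₂
      complete j vz with ∈-es₂ j
      ... | here r                              = inj₂ r
      ... | there (here r)                      = inj₁ r
      ... | there (there (here refl))           = contradiction (joins-other j (joins-sym (proj₂ wc))) (proj₂ vz)
      ... | there (there (there (here refl)))   = contradiction (joins-other j (joins-sym (proj₂ vc))) (proj₁ vz)
      split : ∀ {f} → EdgeS G v w f → Inner f ⊎ f ≡ e₁ ⊎ f ≡ e₂
      split {f} (vs , vt) with src f ≟ c | tgt f ≟ c
      ... | yes refl | _        = inj₂ (complete (joins f) vt)
      ... | no _     | yes refl = inj₂ (complete (joins-sym {f} (joins f)) vs)
      ... | no s≢c   | no t≢c   = inj₁ ((vs , s≢c) , (vt , t≢c))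
      completeStar : CompleteStar e₁ e₂ y₁ y₂
      completeStar = record
        { e₁≢e₂ = λ r → e₂∉ (here (sym r)) ; j₁ = j₁ ; j₂ = j₂
        ; u₁ = fresh-end e₁∉ j₁ y₁≢c ; u₂ = fresh-end (e₂∉ ∘ there) j₂ y₂≢c ; split = split }
        , λ j uz → complete j (proj₁ uz)
    first : (∃ λ f → f ∉ es₀ × ∃ λ y → Joins G f c y) → Result
    first (e₁ , e₁∉ , y₁ , j₁) with y₁ ≟ c
    ... | yes refl = inj₁ (e₁ , j₁)
    -- The edges known so far have 1 + 2 = 3 incidences at `c`, one short of its degree.
    ... | no y₁≢c  = second (star-extend (¬Any⇒All¬ _ e₁∉ ∷ unique₀)
                       (below (e₁ ∷ es₀) (cong₂ _+_ (nonloop-incidence j₁ (≢-sym y₁≢c)) sum₀) ≤-refl))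
      where
      second : (∃ λ f → f ∉ e₁ ∷ es₀ × ∃ λ y → Joins G f c y) → Result
      second (e₂ , e₂∉ , y₂ , j₂) with y₂ ≟ c
      ... | yes refl = inj₁ (e₂ , j₂)
      ... | no y₂≢c  = inj₂ (e₁ , e₂ , y₁ , y₂ , completeStar e₁∉ e₂∉ j₁ j₂ y₁≢c y₂≢c)

  module _ {e₁ e₂ y₁ y₂} (cs : CompleteStar e₁ e₂ y₁ y₂) where

    open Star (proj₁ cs)

    cut-formula : ∀ {ψ φ} → Config (ψ , φ) → (s : V → Bool) →
                  (∀ {x y} → U x → U y → sep φ x y ≡ s x xor s y) →
                  cutParity (ψ , φ) ≡ s a xor (s b xor (s d xor (s e xor (s y₁ xor s y₂))))
    cut-formula {ψ} {φ} (bp , _) s sep≡ = begin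
      cutParity (ψ , φ)                     ≡⟨ xor-identityʳ _ ⟨
      cutParity (ψ , φ) xor false           ≡⟨ cong (cutParity (ψ , φ) xor_) (xor-same (⨁ fs outer)) ⟨
      -- The outer sum is added twice: one copy completes the cut to the handshake sum of `s̃`,
      -- which vanishes, and the other copy is the answer. As `s̃` is `false` outside `U`, an edge
      -- that leaves S - c contributes the colour of its inner end.
      cutParity (ψ , φ) xor (⨁ fs outer xor ⨁ fs outer) ≡⟨ xor-assoc (cutParity (ψ , φ)) _ _ ⟨
      (cutParity (ψ , φ) xor ⨁ fs outer) xor ⨁ fs outer ≡⟨ cong (_xor ⨁ fs outer) (⨁-xor fs (crosses (ψ , φ)) outer) ⟨
      ⨁ fs (λ f → crosses (ψ , φ) f xor outer f) xor ⨁ fs outer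
        ≡⟨ cong (_xor ⨁ fs outer) (trans (⨁-cong fs (λ f → sym (decompose f))) (handshake even s̃)) ⟩
      ⨁ fs outer
        ≡⟨ ⨁-support outer (Uniqueₚ.allFin⁺ (m G)) unique support (λ {f} _ _ → ∈-allFin f) ⟩
      ⨁ es outer
        ≡⟨ cong₂ _xor_ (outer-at (proj₂ wa) ¬uw ua) (cong₂ _xor_ (outer-at (proj₂ wb) ¬uw ub)
             (cong₂ _xor_ (outer-at (proj₂ vd) ¬uv ud) (cong₂ _xor_ (outer-at (proj₂ ve) ¬uv ue)
             (cong₂ _xor_ (outer-at j₁ ¬uc u₁) (trans (xor-identityʳ _) (outer-at j₂ ¬uc u₂)))))) ⟩
      s a xor (s b xor (s d xor (s e xor (s y₁ xor s y₂)))) ∎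
      where
      open ≡-Reasoning
      fs = allFin (m G)
      even : ∀ x → odd (deg G x) ≡ false
      even x = cong odd (deg4 x)
      ¬uw : ¬ U w
      ¬uw ((_ , r) , _) = r refl
      ¬uv : ¬ U v
      ¬uv ((r , _) , _) = r refl
      ¬uc : ¬ U c
      ¬uc (_ , r) = r refl
      s̃ : V → Bool
      s̃ x = does (U? x) ∧ s x
      s̃-in : ∀ {x} → U x → s̃ x ≡ s x
      s̃-in {x} ux = cong (_∧ s x) (dec-true (U? x) ux)
      s̃-out : ∀ {x} → ¬ U x → s̃ x ≡ false
      s̃-out {x} ¬ux = cong (_∧ s x) (dec-false (U? x) ¬ux)
      inner? : Decidable Inner
      inner? f = U? (src f) ×-dec U? (tgt f)
      outer : E → Bool
      outer f = not (does (inner? f)) ∧ (s̃ (src f) xor s̃ (tgt f))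
      decompose : ∀ f → s̃ (src f) xor s̃ (tgt f) ≡ crosses (ψ , φ) f xor outer f
      decompose f with toSum (inner? f)
      ... | inj₂ ¬i = sym (cong₂ (λ p q → (p ∧ sep φ (src f) (tgt f)) xor (not q ∧ (s̃ (src f) xor s̃ (tgt f))))
                        (dec-false (f ∈ˢ? ψ) λ f∈ψ → ¬i (Equivalence.to (proj₁ (bp f)) (inj₁ f∈ψ)))
                        (dec-false (inner? f) ¬i))
      ... | inj₁ i@(us , ut) = begin
        s̃ (src f) xor s̃ (tgt f)             ≡⟨ cong₂ _xor_ (s̃-in us) (s̃-in ut) ⟩
        s (src f) xor s (tgt f)             ≡⟨ sep≡ us ut ⟨
        sep φ (src f) (tgt f)               ≡⟨ member (Equivalence.from (proj₁ (bp f)) i) ⟩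
        crosses (ψ , φ) f                   ≡⟨ xor-identityʳ _ ⟨
        crosses (ψ , φ) f xor false
          ≡⟨ cong (λ q → crosses (ψ , φ) f xor (not q ∧ (s̃ (src f) xor s̃ (tgt f)))) (dec-true (inner? f) i) ⟨
        crosses (ψ , φ) f xor outer f       ∎
        where
        member : f ∈ˢ ψ ⊎ f ∈ˢ φ → sep φ (src f) (tgt f) ≡ crosses (ψ , φ) f
        member (inj₁ f∈ψ) = sym (cong (_∧ sep φ (src f) (tgt f)) (dec-true (f ∈ˢ? ψ) f∈ψ))
        member (inj₂ f∈φ) = trans sep-false (sym (trans (cong (does (f ∈ˢ? ψ) ∧_) sep-false) (∧-zeroʳ _)))
          where
          sep-false : sep φ (src f) (tgt f) ≡ false
          sep-false = sep-walk (walk-edge f∈φ (joins f))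
      es : List E
      es = proj₁ wa ∷ proj₁ wb ∷ proj₁ vd ∷ proj₁ ve ∷ e₁ ∷ e₂ ∷ []
      w≢v = ≢-sym v≢w
      unique : Unique es
      unique =
        (joins-distinct (joins-sym (proj₂ wa)) (proj₂ wb) (≢-sym (w≢ ua)) a≢b
          ∷ joins-distinct (proj₂ wa) (proj₂ vd) w≢v (w≢ ud) ∷ joins-distinct (proj₂ wa) (proj₂ ve) w≢v (w≢ ue)
          ∷ joins-distinct (proj₂ wa) j₁ w≢c (w≢ u₁) ∷ joins-distinct (proj₂ wa) j₂ w≢c (w≢ u₂) ∷ [])
        ∷ (joins-distinct (proj₂ wb) (proj₂ vd) w≢v (w≢ ud) ∷ joins-distinct (proj₂ wb) (proj₂ ve) w≢v (w≢ ue)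
          ∷ joins-distinct (proj₂ wb) j₁ w≢c (w≢ u₁) ∷ joins-distinct (proj₂ wb) j₂ w≢c (w≢ u₂) ∷ [])
        ∷ (joins-distinct (joins-sym (proj₂ vd)) (proj₂ ve) (≢-sym (v≢ ud)) d≢e
          ∷ joins-distinct (proj₂ vd) j₁ v≢c (v≢ u₁) ∷ joins-distinct (proj₂ vd) j₂ v≢c (v≢ u₂) ∷ [])
        ∷ (joins-distinct (proj₂ ve) j₁ v≢c (v≢ u₁) ∷ joins-distinct (proj₂ ve) j₂ v≢c (v≢ u₂) ∷ [])
        ∷ (e₁≢e₂ ∷ []) ∷ [] ∷ []
      boundary : ∀ {f x z} → Joins G f x z → ¬ U x → U z → f ∈ es
      boundary {f} {x} j ¬ux uz with x ≟ v | x ≟ w | x ≟ c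
      ... | yes refl | _ | _ with v-star j (≢-sym (w≢ uz))
      ...   | inj₁ (_ , r)        = contradiction r (≢-sym (c≢ uz))
      ...   | inj₂ (inj₁ (r , _)) = there (there (here r))
      ...   | inj₂ (inj₂ (r , _)) = there (there (there (here r)))
      boundary j ¬ux uz | no _ | yes refl | _ with w-star j (≢-sym (v≢ uz))
      ...   | inj₁ (r , _)        = here r
      ...   | inj₂ (inj₁ (r , _)) = there (here r)
      ...   | inj₂ (inj₂ (_ , r)) = contradiction r (≢-sym (c≢ uz))
      boundary j ¬ux uz | no _ | no _ | yes refl with proj₂ cs j uz
      ...   | inj₁ r = there (there (there (there (here r))))
      ...   | inj₂ r = there (there (there (there (there (here r)))))
      boundary j ¬ux uz | no x≢v | no x≢w | no x≢c = contradiction ((x≢v , x≢w) , x≢c) ¬ux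
      support : ∀ {f} → f ∈ fs → outer f ≡ true → f ∈ es
      support {f} _ t with U? (src f) | U? (tgt f)
      ... | yes us | no ¬ut = boundary (joins-sym {f} (joins f)) ¬ut us
      ... | no ¬us | yes ut = boundary (joins f) ¬us ut
      support {f} _ () | yes us | yes ut
      support {f} _ () | no ¬us | no ¬ut
      outer-at : ∀ {f x z} → Joins G f x z → ¬ U x → U z → outer f ≡ s z
      outer-at {f} j ¬ux uz with joins-same j (joins f)
      ... | inj₁ (refl , refl) = cong₂ _∧_ (cong not (dec-false (inner? f) (¬ux ∘ proj₁))) (cong₂ _xor_ (s̃-out ¬ux) (s̃-in uz))
      ... | inj₂ (refl , refl) = trans (cong₂ _∧_ (cong not (dec-false (inner? f) (¬ux ∘ proj₂))) (cong₂ _xor_ (s̃-in uz) (s̃-out ¬ux))) (xor-identityʳ _)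

  -- Parity of the union, the involution and the sum of the four sizes

  SPa SPb SPd SPe : ESet G × ESet G → Set
  SPa = InSP G v w (a ∷ []) (b ∷ c ∷ d ∷ e ∷ [])
  SPb = InSP G v w (b ∷ []) (a ∷ c ∷ d ∷ e ∷ [])
  SPd = InSP G v w (d ∷ []) (a ∷ b ∷ c ∷ e ∷ [])
  SPe = InSP G v w (e ∷ []) (a ∷ b ∷ c ∷ d ∷ [])

  spa? : Decidable SPa
  spa? = inSP? G v w _ _
  spb? : Decidable SPb
  spb? = inSP? G v w _ _
  spd? : Decidable SPd
  spd? = inSP? G v w _ _
  spe? : Decidable SPe
  spe? = inSP? G v w _ _

  total : ESet G × ESet G → Bool
  total p = does (spa? p) xor (does (spb? p) xor (does (spd? p) xor does (spe? p)))

  ⨁-xor₄ : (f g h k : ESet G × ESet G → Bool) →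
           ⨁ pairs (λ p → f p xor (g p xor (h p xor k p))) ≡
           ⨁ pairs f xor (⨁ pairs g xor (⨁ pairs h xor ⨁ pairs k))
  ⨁-xor₄ f g h k = trans (⨁-xor pairs f _) (cong (⨁ pairs f xor_)
                     (trans (⨁-xor pairs g _) (cong (⨁ pairs g xor_) (⨁-xor pairs h k))))

  total-even : ⨁ pairs total ≡ false
  total-even with loop-or-star
  ... | inj₁ (f , j) = trans (⨁-cong pairs λ p →
          cong₂ _xor_ (none (spa? p)) (cong₂ _xor_ (none (spb? p)) (cong₂ _xor_ (none (spd? p)) (none (spe? p)))))
        (⨁-false pairs)
    where
    none : ∀ {P Q p} (q? : Dec (InSP G v w P Q p)) → does q? ≡ false
    none q? = dec-false q? (inSP-no-loop G v w c-vert j)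
  ... | inj₂ (e₁ , e₂ , y₁ , y₂ , cs@(S , _)) = begin
    ⨁ pairs total
      ≡⟨ ⨁-xor₄ _ _ _ _ ⟩
    ⨁ pairs (does ∘ spa?) xor (⨁ pairs (does ∘ spb?) xor (⨁ pairs (does ∘ spd?) xor ⨁ pairs (does ∘ spe?)))
      ≡⟨ cong₂ _xor_ (inSP-sum ua ub ud ue _ (prep b (↭-sym (shift c (d ∷ e ∷ []) []))) S)
        (cong₂ _xor_ (inSP-sum ub ua ud ue _ (prep a (↭-sym (shift c (d ∷ e ∷ []) []))) S)
        (cong₂ _xor_ (inSP-sum ud ua ub ue _ (prep a (prep b (↭-sym (shift c (e ∷ []) [])))) S)
                     (inSP-sum ue ua ub ud _ (prep a (prep b (↭-sym (shift c (d ∷ []) [])))) S))) ⟩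
    ⨁ pairs (λ p → K p ∧ Δ a b d e p) xor (⨁ pairs (λ p → K p ∧ Δ b a d e p) xor
    (⨁ pairs (λ p → K p ∧ Δ d a b e p) xor ⨁ pairs (λ p → K p ∧ Δ e a b d p)))
      ≡⟨ ⨁-xor₄ _ _ _ _ ⟨
    ⨁ pairs (λ p → (K p ∧ Δ a b d e p) xor ((K p ∧ Δ b a d e p) xor ((K p ∧ Δ d a b e p) xor (K p ∧ Δ e a b d p))))
      ≡⟨ ⨁-cong pairs pointwise ⟩
    ⨁ pairs (λ p → K p ∧ (sep (proj₂ p) y₁ y₂ ∧ not (cutParity p)))
      ≡⟨ even-cuts-even (Star.u₁ S) (Star.u₂ S) ⟩
    false ∎
    where
    open ≡-Reasoning
    open Star S using (u₁; u₂)
    K : ESet G × ESet G → Bool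
    K p = does (config? p)
    Δ : (x o₁ o₂ o₃ : Vtx G) → ESet G × ESet G → Bool
    Δ x o₁ o₂ o₃ p = does (alone? x o₁ o₂ o₃ y₂ (proj₂ p)) xor does (alone? x o₁ o₂ o₃ y₁ (proj₂ p))
    pointwise : ∀ p → (K p ∧ Δ a b d e p) xor ((K p ∧ Δ b a d e p) xor ((K p ∧ Δ d a b e p) xor (K p ∧ Δ e a b d p)))
                    ≡ K p ∧ (sep (proj₂ p) y₁ y₂ ∧ not (cutParity p))
    pointwise p@(ψ , φ) with config? p
    ... | no _ = refl
    ... | yes cfg@(_ , _ , _ , _ , two) = begin
      Δ a b d e p xor (Δ b a d e p xor (Δ d a b e p xor Δ e a b d p))
        ≡⟨ cong₂ _xor_ (Δ≡ ua ub ud ue) (cong₂ _xor_ (Δ≡ ub ua ud ue) (cong₂ _xor_ (Δ≡ ud ua ub ue) (Δ≡ ue ua ub ud))) ⟩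
      _ ≡⟨ alone-parity (s a) (s b) (s d) (s e) (s y₁) (s y₂) ⟩
      (s y₁ xor s y₂) ∧ not (s a xor (s b xor (s d xor (s e xor (s y₁ xor s y₂)))))
        ≡⟨ cong₂ (λ t k → t ∧ not k) (sep≡ u₁ u₂) (cut-formula cs cfg s sep≡) ⟨
      sep φ y₁ y₂ ∧ not (cutParity p) ∎
      where
      -- The colouring of S - c by the trees of `φ`, with `false` for the tree of `y₁`; by
      -- `sep-xor`, two vertices are separated exactly when their colours differ.
      s : Vtx G → Bool
      s z = sep φ y₁ z
      sep≡ : ∀ {x z} → U x → U z → sep φ x z ≡ s x xor s z
      sep≡ {x} {z} ux uz = trans (sep-xor two ux u₁ uz)
        (cong (_xor s z) (cong not (does-⇔ (mk⇔ walk-sym walk-sym) (walk? φ x y₁) (walk? φ y₁ x))))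
      joined≡ : ∀ {x z} → U x → U z → does (walk? φ x z) ≡ not (s x xor s z)
      joined≡ ux uz = trans (sym (not-involutive _)) (cong not (sep≡ ux uz))
      alone≡ : ∀ {x o₁ o₂ o₃ y} → U x → U o₁ → U o₂ → U o₃ → U y →
               does (alone? x o₁ o₂ o₃ y φ) ≡ aloneᵇ (s x) (s o₁) (s o₂) (s o₃) (s y)
      alone≡ ux uo₁ uo₂ uo₃ uy =
        cong₂ _∧_ (joined≡ uo₁ uo₂) (cong₂ _∧_ (joined≡ uo₁ uo₃) (cong₂ _∧_ (joined≡ uo₁ uy) (sep≡ ux uo₁)))
      Δ≡ : ∀ {x o₁ o₂ o₃} → U x → U o₁ → U o₂ → U o₃ →
           Δ x o₁ o₂ o₃ p ≡ aloneᵇ (s x) (s o₁) (s o₂) (s o₃) (s y₂) xor aloneᵇ (s x) (s o₁) (s o₂) (s o₃) (s y₁)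
      Δ≡ ux uo₁ uo₂ uo₃ = cong₂ _xor_ (alone≡ ux uo₁ uo₂ uo₃ u₂) (alone≡ ux uo₁ uo₂ uo₃ u₁)

  Union : ESet G × ESet G → Set
  Union p = SPa p ⊎ SPb p ⊎ SPd p ⊎ SPe p

  union? : Decidable Union
  union? p = spa? p ⊎-dec spb? p ⊎-dec spd? p ⊎-dec spe? p

  does-union : ∀ p → does (union? p) ≡ total p
  does-union p =
    trans (does-⊎-disjoint (spa? p) (spb? p ⊎-dec spd? p ⊎-dec spe? p) λ
             { (α , inj₁ β)        → inSP-disjoint G v w b₁ c₂ c₂ α β
             ; (α , inj₂ (inj₁ δ)) → inSP-disjoint G v w d₃ c₂ c₃ α δ
             ; (α , inj₂ (inj₂ ε)) → inSP-disjoint G v w e₄ c₂ c₃ α ε })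
    (cong (does (spa? p) xor_)
    (trans (does-⊎-disjoint (spb? p) (spd? p ⊎-dec spe? p) λ
             { (β , inj₁ δ) → inSP-disjoint G v w d₃ c₂ c₃ β δ
             ; (β , inj₂ ε) → inSP-disjoint G v w e₄ c₂ c₃ β ε })
    (cong (does (spb? p) xor_)
    (does-⊎-disjoint (spd? p) (spe? p) λ { (δ , ε) → inSP-disjoint G v w e₄ c₃ c₃ δ ε }))))
    where
    b₁ : ∀ {x y z} → b ∈ (b ∷ x ∷ y ∷ z ∷ [])
    b₁ = here refl
    c₂ : ∀ {x y z} → c ∈ (x ∷ c ∷ y ∷ z ∷ [])
    c₂ = there (here refl)
    c₃ : ∀ {x y z} → c ∈ (x ∷ y ∷ c ∷ z ∷ [])
    c₃ = there (there (here refl))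
    d₃ : ∀ {x y z} → d ∈ (x ∷ y ∷ d ∷ z ∷ [])
    d₃ = there (there (here refl))
    e₄ : ∀ {x y z} → e ∈ (x ∷ y ∷ z ∷ e ∷ [])
    e₄ = there (there (there (here refl)))

  union-enumeration : Enumerates Union (filter union? pairs)
  union-enumeration = Uniqueₚ.filter⁺ union? pairs-unique ,
    λ p → mk⇔ (proj₂ ∘ ∈-filter⁻ union? {xs = pairs}) (∈-filter⁺ union? (∈-pairs p))

  involution : ∃ λ (ι : Σ (ESet G × ESet G) Union → Σ (ESet G × ESet G) Union) →
               (∀ x → proj₁ (ι (ι x)) ≡ proj₁ x) × (∀ x → proj₁ (ι x) ≢ proj₁ x)
  involution = even-enumerable⇒involution (×-≡-dec (Vec-≡-dec Bool._≟_) (Vec-≡-dec Bool._≟_))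
    union-enumeration
    (trans (enumerates-parity pairs-unique ∈-pairs union? union-enumeration)
           (trans (⨁-cong pairs does-union) total-even))

  lengths-even : ∀ L₁ L₂ L₃ L₄ → Enumerates SPa L₁ → Enumerates SPb L₂ → Enumerates SPd L₃ → Enumerates SPe L₄ →
                 2 ∣ (length L₁ + length L₂ + length L₃ + length L₄)
  lengths-even L₁ L₂ L₃ L₄ E₁ E₂ E₃ E₄ = even⇒2∣ _ (begin
    odd (l₁ + l₂ + l₃ + l₄)                             ≡⟨ odd-+ (l₁ + l₂ + l₃) l₄ ⟩
    odd (l₁ + l₂ + l₃) xor odd l₄                       ≡⟨ cong (_xor odd l₄) (odd-+ (l₁ + l₂) l₃) ⟩
    (odd (l₁ + l₂) xor odd l₃) xor odd l₄               ≡⟨ xor-assoc (odd (l₁ + l₂)) _ _ ⟩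
    odd (l₁ + l₂) xor (odd l₃ xor odd l₄)               ≡⟨ cong (_xor (odd l₃ xor odd l₄)) (odd-+ l₁ l₂) ⟩
    (odd l₁ xor odd l₂) xor (odd l₃ xor odd l₄)         ≡⟨ xor-assoc (odd l₁) _ _ ⟩
    odd l₁ xor (odd l₂ xor (odd l₃ xor odd l₄))
      ≡⟨ cong₂ _xor_ (parity spa? E₁) (cong₂ _xor_ (parity spb? E₂) (cong₂ _xor_ (parity spd? E₃) (parity spe? E₄))) ⟩
    ⨁ pairs (does ∘ spa?) xor (⨁ pairs (does ∘ spb?) xor (⨁ pairs (does ∘ spd?) xor ⨁ pairs (does ∘ spe?)))
      ≡⟨ ⨁-xor₄ _ _ _ _ ⟨
    ⨁ pairs total                                       ≡⟨ total-even ⟩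
    false                                               ∎)
    where
    open ≡-Reasoning
    l₁ = length L₁
    l₂ = length L₂
    l₃ = length L₃
    l₄ = length L₄
    parity : {P : ESet G × ESet G → Set} {L : List (ESet G × ESet G)} (P? : Decidable P) →
             Enumerates P L → odd (length L) ≡ ⨁ pairs (does ∘ P?)
    parity = enumerates-parity pairs-unique ∈-pairs

theorem4p8 : (G : Graph) → Connected G → (∀ x → deg G x ≡ 4)
    → (v w a b c d e : Vtx G)
    → Unique (w ∷ v ∷ a ∷ b ∷ c ∷ d ∷ e ∷ [])
    → Adj G v w
    → (∀ y → Adj G w y ⇔ y ∈ (v ∷ a ∷ b ∷ c ∷ []))
    → (∀ y → Adj G v y ⇔ y ∈ (w ∷ c ∷ d ∷ e ∷ []))
    → (∃ λ (ι : Σ (ESet G × ESet G) (λ p → InSP G v w (a ∷ []) (b ∷ c ∷ d ∷ e ∷ []) p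
    ⊎ InSP G v w (b ∷ []) (a ∷ c ∷ d ∷ e ∷ []) p
    ⊎ InSP G v w (d ∷ []) (a ∷ b ∷ c ∷ e ∷ []) p
    ⊎ InSP G v w (e ∷ []) (a ∷ b ∷ c ∷ d ∷ []) p)
    → Σ (ESet G × ESet G) (λ p → InSP G v w (a ∷ []) (b ∷ c ∷ d ∷ e ∷ []) p
    ⊎ InSP G v w (b ∷ []) (a ∷ c ∷ d ∷ e ∷ []) p
    ⊎ InSP G v w (d ∷ []) (a ∷ b ∷ c ∷ e ∷ []) p
    ⊎ InSP G v w (e ∷ []) (a ∷ b ∷ c ∷ d ∷ []) p))
    → (∀ x → proj₁ (ι (ι x)) ≡ proj₁ x) × (∀ x → proj₁ (ι x) ≢ proj₁ x))
    × ((L₁ L₂ L₃ L₄ : List (ESet G × ESet G))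
    → Enumerates (InSP G v w (a ∷ []) (b ∷ c ∷ d ∷ e ∷ [])) L₁
    → Enumerates (InSP G v w (b ∷ []) (a ∷ c ∷ d ∷ e ∷ [])) L₂
    → Enumerates (InSP G v w (d ∷ []) (a ∷ b ∷ c ∷ e ∷ [])) L₃
    → Enumerates (InSP G v w (e ∷ []) (a ∷ b ∷ c ∷ d ∷ [])) L₄
    → 2 ∣ (length L₁ + length L₂ + length L₃ + length L₄))
theorem4p8 G _ deg4 v w a b c d e
  ((w≢v ∷ w≢a ∷ w≢b ∷ w≢c ∷ w≢d ∷ w≢e ∷ []) ∷ (v≢a ∷ v≢b ∷ v≢c ∷ v≢d ∷ v≢e ∷ [])
   ∷ (a≢b ∷ a≢c ∷ _) ∷ (b≢c ∷ _) ∷ (c≢d ∷ c≢e ∷ []) ∷ (d≢e ∷ []) ∷ _) _ adj-w adj-v =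
  involution , lengths-even
  where
  open Neighbourhood G deg4 v w a b c d e (≢-sym w≢v) (≢-sym v≢c , ≢-sym w≢c) a≢b d≢e
    ((≢-sym v≢a , ≢-sym w≢a) , a≢c) ((≢-sym v≢b , ≢-sym w≢b) , b≢c)
    ((≢-sym v≢d , ≢-sym w≢d) , ≢-sym c≢d) ((≢-sym v≢e , ≢-sym w≢e) , ≢-sym c≢e)
    (λ y → Equivalence.from (adj-w y)) (λ y → Equivalence.from (adj-v y))
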